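{- Let $q>3$ be a prime power and let $d$ be a nonnegative integer. (a) If $d\le q-2$, then the ideal $$\mathcal{I}_{q,d}:=\mathcal{I}_q+\langle x_i\colon i>d\rangle+\langle x_d^{q-1}-1\rangle\subset\mathbb{F}_q[X_q]$$ is zero-dimensional and radical, and $\mathcal{P}_{q,d}$ is identified with its algebraic set $\mathcal{Z}(\mathcal{I}_{q,d})$, via the bijection $(s_0,\ldots,s_{q-2})\mapsto\sum_{i=0}^{q-2}s_ix^i$. In particular, $|\mathcal{P}_{q,d}|=|\mathcal{Z}(\mathcal{I}_{q,d})|=\dim_{\mathbb{F}_q}(\mathbb{F}_q[X_q]/\mathcal{I}_{q,d})$. (b) The ideal $$\mathcal{J}_{q,d}:=\mathcal{J}_q+\langle x_{ij}\colon i+j>d\rangle+\Big\langle\prod_{i+j=d}(x_{ij}^{q-1}-1)\Big\rangle\subset\mathbb{F}_q[\overline{X}_q]$$ is zero-dimensional and radical, and $\mathcal{LP}_{q,d}$ is identified with its algebraic set $\mathcal{Z}(\mathcal{J}_{q,d})$, via the bijection $(s_{ij})_{0\le i,j\le q-2}\mapsto\sum_{i,j=0}^{q-2}s_{ij}x^iy^j$. As a consequence, $|\mathcal{LP}_{q,d}|=|\mathcal{Z}(\mathcal{J}_{q,d})|=\dim_{\mathbb{F}_q}(\mathbb{F}_q[\overline{X}_q]/\mathcal{J}_{q,d})$.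
   Context: $\mathbb{F}_q$ is the finite field with $q$ elements. $\mathcal{P}_q$ is the set of permutation polynomials: polynomials in $\mathbb{F}_q[x]$ of degree less than $q$ that act as permutations of $\mathbb{F}_q$; $\mathcal{P}_{q,d}$ is the subset of those of degree $d$. $\mathcal{LP}_q$ is the set of local permutation polynomials: polynomials $f\in\mathbb{F}_q[x,y]$ of degree less than $q$ in each variable such that, for every $a\in\mathbb{F}_q$, both $f(x,a)$ and $f(a,x)$ act as permutations of $\mathbb{F}_q$; $\mathcal{LP}_{q,d}$ is the subset of those of total degree $d$. $X_q:=\{x_i\colon 0\le i\le q-2\}$ and $\overline{X}_q:=\{x_{ij}\colon 0\le i,j\le q-2\}$ are sets of variables; all indices in the ideals range over $\{0,\ldots,q-2\}$, and an empty product is $1$. Put $F(x):=x^{q-1}-1$ and, for $a,b,c\in\mathbb{F}_q$ with $a\ne b$ (with $0^0=1$), $F_{a,b}:=F(\sum_{i=0}^{q-2}(a^i-b^i)x_i)$, $G^{\mathrm{row}}_{a,b,c}:=F(\sum_{i,j=0}^{q-2}(a^i-b^i)c^jx_{ji})$, $G^{\mathrm{col}}_{a,b,c}:=F(\sum_{i,j=0}^{q-2}(a^i-b^i)c^jx_{ij})$. Then $$\mathcal{I}_q:=\langle F_{a,b}\colon a,b\in\mathbb{F}_q,\ a\neq b\rangle+\langle x_i^q-x_i\colon 0\le i\le q-2\rangle\subset\mathbb{F}_q[X_q],$$ $$\mathcal{J}_q:=\langle G^{\mathrm{row}}_{a,b,c},\,G^{\mathrm{col}}_{a,b,c}\colon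 a,b,c\in\mathbb{F}_q,\ a\neq b\rangle+\langle x_{ij}^q-x_{ij}\colon 0\le i,j\le q-2\rangle\subset\mathbb{F}_q[\overline{X}_q].$$ For an ideal $I$ of a polynomial ring over $\mathbb{F}_q$ in $n$ variables, $\mathcal{Z}(I)$ denotes the set of points of $\mathbb{F}_q^n$ at which all elements of $I$ vanish; $I$ is zero-dimensional if the quotient ring by $I$ is a finite-dimensional $\mathbb{F}_q$-vector space. -}

module Defs where

open import Level as Level using (Level; _⊔_)
open import Algebra.Bundles using (CommutativeRing; Semiring)
open import Algebra.Module.Bundles using (Module)
open import Algebra.Module.Structures.Biased using (IsModuleFromLeft)
import Algebra.Definitions.RawMonoid as RawMonoidOps
import Algebra.Definitions.RawSemiring as RawSemiringOps
import Algebra.Properties.AbelianGroup as AbelianGroupProps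
import Algebra.Properties.CommutativeSemigroup as CommutativeSemigroupProps
import Algebra.Properties.Ring as RingProps
open import Data.Bool.Base using (if_then_else_)
open import Data.Fin.Base using (Fin; zero; suc; toℕ; combine)
open import Data.List.Base as List using (List; []; _∷_)
open import Data.Nat.Base as ℕ using (ℕ; zero; suc; z≤n; s≤s)
open import Data.Nat.Primality using (Prime)
open import Data.Nat.Properties as ℕ using ()
open import Data.Product.Base using (Σ; ∃; ∃₂; ∃-syntax; _×_; _,_; proj₁)
open import Data.Sum.Base using (_⊎_; [_,_])
open import Data.Unit.Base using (⊤)
open import Data.Vec.Functional as Vec using (Vector)
import Data.Vec.Functional.Relation.Binary.Pointwise.Properties as Pointwise
open import Function.Bundles using (Inverse)
open import Function.Definitions using (Bijective)
open import Relation.Binary.Bundles using (Setoid)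
import Relation.Binary.Construct.On as On
open import Relation.Binary.PropositionalEquality as ≡ using (_≡_)
import Relation.Binary.Reasoning.Setoid as SetoidReasoning
open import Relation.Nullary using (¬_; does)
open import Relation.Unary using (Pred)

private
  variable
    c ℓ p p′ ι m ℓm : Level

IsPrimePower : ℕ → Set
IsPrimePower q = ∃₂ λ p k → Prime p × q ≡ p ℕ.^ suc k

HasCardinality : Setoid c ℓ → ℕ → Set (c ⊔ ℓ)
HasCardinality S k = Inverse S (≡.setoid (Fin k))

record FiniteField (c ℓ : Level) (q : ℕ) : Set (Level.suc (c ⊔ ℓ)) where
  field
    commutativeRing : CommutativeRing c ℓ
  open CommutativeRing commutativeRing public
  field
    1≉0         : ¬ (1# ≈ 0#)
    inverse     : ∀ x → ¬ (x ≈ 0#) → ∃[ y ] x * y ≈ 1#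
    cardinality : HasCardinality setoid q

-- A list a₀ ∷ a₁ ∷ ⋯ of coefficients represents a₀ + a₁ x + ⋯.  Trailing
-- zeros are allowed, so equality compares all coefficients.

module Univariate (R : CommutativeRing c ℓ) where
  open CommutativeRing R hiding (zero)
  open RingProps ring using (-0#≈0#)
  open CommutativeSemigroupProps
    (CommutativeRing.+-commutativeSemigroup R) using (interchange; x∙yz≈y∙xz)

  private
    module Rₛ = SetoidReasoning setoid

  coeff : List Carrier → ℕ → Carrier
  coeff []      _       = 0#
  coeff (a ∷ _) zero    = a
  coeff (_ ∷ f) (suc k) = coeff f k

  infix  4 _≈ₚ_
  infixl 6 _+ₚ_
  infixl 7 _*ₚ_ _·ₚ_

  record _≈ₚ_ (f g : List Carrier) : Set ℓ where
    constructor coeffwise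
    field coeff-≈ : ∀ k → coeff f k ≈ coeff g k
  open _≈ₚ_ public

  _+ₚ_ : List Carrier → List Carrier → List Carrier
  []      +ₚ g       = g
  (a ∷ f) +ₚ []      = a ∷ f
  (a ∷ f) +ₚ (b ∷ g) = (a + b) ∷ (f +ₚ g)

  -ₚ_ : List Carrier → List Carrier
  -ₚ_ = List.map (-_)

  _·ₚ_ : Carrier → List Carrier → List Carrier
  a ·ₚ f = List.map (a *_) f

  _*ₚ_ : List Carrier → List Carrier → List Carrier
  []      *ₚ g = []
  (a ∷ f) *ₚ g = (a ·ₚ g) +ₚ (0# ∷ (f *ₚ g))

  ≈ₚ-refl : ∀ {f} → f ≈ₚ f
  ≈ₚ-refl = coeffwise λ _ → refl

  ≈ₚ-sym : ∀ {f g} → f ≈ₚ g → g ≈ₚ f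
  ≈ₚ-sym (coeffwise e) = coeffwise λ k → sym (e k)

  ≈ₚ-trans : ∀ {f g h} → f ≈ₚ g → g ≈ₚ h → f ≈ₚ h
  ≈ₚ-trans (coeffwise d) (coeffwise e) = coeffwise λ k → trans (d k) (e k)

  ≈ₚ-setoid : Setoid _ _
  ≈ₚ-setoid = record
    { _≈_ = _≈ₚ_
    ; isEquivalence = record { refl = ≈ₚ-refl ; sym = ≈ₚ-sym ; trans = ≈ₚ-trans }
    }

  private
    module Pₛ = SetoidReasoning ≈ₚ-setoid

  coeff-+ : ∀ f g k → coeff (f +ₚ g) k ≈ coeff f k + coeff g k
  coeff-+ []      g       k       = sym (+-identityˡ _)
  coeff-+ (a ∷ f) []      k       = sym (+-identityʳ _)
  coeff-+ (a ∷ f) (b ∷ g) zero    = refl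
  coeff-+ (a ∷ f) (b ∷ g) (suc k) = coeff-+ f g k

  coeff-neg : ∀ f k → coeff (-ₚ f) k ≈ - coeff f k
  coeff-neg []      k       = sym -0#≈0#
  coeff-neg (a ∷ f) zero    = refl
  coeff-neg (a ∷ f) (suc k) = coeff-neg f k

  coeff-· : ∀ a f k → coeff (a ·ₚ f) k ≈ a * coeff f k
  coeff-· a []      k       = sym (zeroʳ a)
  coeff-· a (b ∷ f) zero    = refl
  coeff-· a (b ∷ f) (suc k) = coeff-· a f k

  ∷-cong : ∀ {a b f g} → a ≈ b → f ≈ₚ g → a ∷ f ≈ₚ b ∷ g
  ∷-cong a≈b f≈g = coeffwise λ { zero → a≈b ; (suc k) → coeff-≈ f≈g k }

  0∷[]≈[] : 0# ∷ [] ≈ₚ []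
  0∷[]≈[] = coeffwise λ { zero → refl ; (suc k) → refl }

  +ₚ-cong : ∀ {f f′ g g′} → f ≈ₚ f′ → g ≈ₚ g′ → f +ₚ g ≈ₚ f′ +ₚ g′
  +ₚ-cong {f} {f′} {g} {g′} d e = coeffwise λ k → let open Rₛ in begin
    coeff (f +ₚ g) k         ≈⟨ coeff-+ f g k ⟩
    coeff f k + coeff g k    ≈⟨ +-cong (coeff-≈ d k) (coeff-≈ e k) ⟩
    coeff f′ k + coeff g′ k  ≈⟨ coeff-+ f′ g′ k ⟨
    coeff (f′ +ₚ g′) k       ∎

  +ₚ-assoc : ∀ f g h → (f +ₚ g) +ₚ h ≈ₚ f +ₚ (g +ₚ h)
  +ₚ-assoc f g h = coeffwise λ k → let open Rₛ in begin
    coeff ((f +ₚ g) +ₚ h) k              ≈⟨ coeff-+ (f +ₚ g) h k ⟩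
    coeff (f +ₚ g) k + coeff h k         ≈⟨ +-congʳ (coeff-+ f g k) ⟩
    (coeff f k + coeff g k) + coeff h k  ≈⟨ +-assoc _ _ _ ⟩
    coeff f k + (coeff g k + coeff h k)  ≈⟨ +-congˡ (coeff-+ g h k) ⟨
    coeff f k + coeff (g +ₚ h) k         ≈⟨ coeff-+ f (g +ₚ h) k ⟨
    coeff (f +ₚ (g +ₚ h)) k              ∎

  +ₚ-comm : ∀ f g → f +ₚ g ≈ₚ g +ₚ f
  +ₚ-comm f g = coeffwise λ k → let open Rₛ in begin
    coeff (f +ₚ g) k       ≈⟨ coeff-+ f g k ⟩
    coeff f k + coeff g k  ≈⟨ +-comm _ _ ⟩
    coeff g k + coeff f k  ≈⟨ coeff-+ g f k ⟨
    coeff (g +ₚ f) k       ∎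

  +ₚ-identityʳ : ∀ f → f +ₚ [] ≈ₚ f
  +ₚ-identityʳ f = +ₚ-comm f []

  -ₚ-cong : ∀ {f g} → f ≈ₚ g → -ₚ f ≈ₚ -ₚ g
  -ₚ-cong {f} {g} e = coeffwise λ k →
    trans (coeff-neg f k) (trans (-‿cong (coeff-≈ e k)) (sym (coeff-neg g k)))

  -ₚ-inverseˡ : ∀ f → (-ₚ f) +ₚ f ≈ₚ []
  -ₚ-inverseˡ f = coeffwise λ k →
    trans (coeff-+ (-ₚ f) f k) (trans (+-congʳ (coeff-neg f k)) (-‿inverseˡ _))

  -ₚ-inverseʳ : ∀ f → f +ₚ (-ₚ f) ≈ₚ []
  -ₚ-inverseʳ f = ≈ₚ-trans (+ₚ-comm f (-ₚ f)) (-ₚ-inverseˡ f)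

  +ₚ-interchange : ∀ e f g h → (e +ₚ f) +ₚ (g +ₚ h) ≈ₚ (e +ₚ g) +ₚ (f +ₚ h)
  +ₚ-interchange e f g h = coeffwise λ k → let open Rₛ in begin
    coeff ((e +ₚ f) +ₚ (g +ₚ h)) k                       ≈⟨ expand e f g h k ⟩
    (coeff e k + coeff f k) + (coeff g k + coeff h k)  ≈⟨ interchange _ _ _ _ ⟩
    (coeff e k + coeff g k) + (coeff f k + coeff h k)  ≈⟨ expand e g f h k ⟨
    coeff ((e +ₚ g) +ₚ (f +ₚ h)) k                       ∎
    where
    expand : ∀ e f g h k → coeff ((e +ₚ f) +ₚ (g +ₚ h)) k ≈
             (coeff e k + coeff f k) + (coeff g k + coeff h k)
    expand e f g h k = trans (coeff-+ (e +ₚ f) (g +ₚ h) k)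
                             (+-cong (coeff-+ e f k) (coeff-+ g h k))

  +ₚ-swap : ∀ f g h → f +ₚ (g +ₚ h) ≈ₚ g +ₚ (f +ₚ h)
  +ₚ-swap f g h = ≈ₚ-trans (≈ₚ-sym (+ₚ-assoc f g h))
    (≈ₚ-trans (+ₚ-cong (+ₚ-comm f g) ≈ₚ-refl) (+ₚ-assoc g f h))

  ·-cong : ∀ {a b f g} → a ≈ b → f ≈ₚ g → a ·ₚ f ≈ₚ b ·ₚ g
  ·-cong {a} {b} {f} {g} d e = coeffwise λ k →
    trans (coeff-· a f k) (trans (*-cong d (coeff-≈ e k)) (sym (coeff-· b g k)))

  ·-distribˡ : ∀ a f g → a ·ₚ (f +ₚ g) ≈ₚ a ·ₚ f +ₚ a ·ₚ g
  ·-distribˡ a f g = coeffwise λ k → let open Rₛ in begin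
    coeff (a ·ₚ (f +ₚ g)) k                ≈⟨ coeff-· a (f +ₚ g) k ⟩
    a * coeff (f +ₚ g) k                   ≈⟨ *-congˡ (coeff-+ f g k) ⟩
    a * (coeff f k + coeff g k)            ≈⟨ distribˡ _ _ _ ⟩
    a * coeff f k + a * coeff g k          ≈⟨ +-cong (coeff-· a f k) (coeff-· a g k) ⟨
    coeff (a ·ₚ f) k + coeff (a ·ₚ g) k    ≈⟨ coeff-+ (a ·ₚ f) (a ·ₚ g) k ⟨
    coeff (a ·ₚ f +ₚ a ·ₚ g) k             ∎

  ·-distribʳ : ∀ a b f → (a + b) ·ₚ f ≈ₚ a ·ₚ f +ₚ b ·ₚ f
  ·-distribʳ a b f = coeffwise λ k → let open Rₛ in begin
    coeff ((a + b) ·ₚ f) k                 ≈⟨ coeff-· (a + b) f k ⟩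
    (a + b) * coeff f k                    ≈⟨ distribʳ _ _ _ ⟩
    a * coeff f k + b * coeff f k          ≈⟨ +-cong (coeff-· a f k) (coeff-· b f k) ⟨
    coeff (a ·ₚ f) k + coeff (b ·ₚ f) k    ≈⟨ coeff-+ (a ·ₚ f) (b ·ₚ f) k ⟨
    coeff (a ·ₚ f +ₚ b ·ₚ f) k             ∎

  ·-·-assoc : ∀ a b f → (a * b) ·ₚ f ≈ₚ a ·ₚ (b ·ₚ f)
  ·-·-assoc a b f = coeffwise λ k → let open Rₛ in begin
    coeff ((a * b) ·ₚ f) k    ≈⟨ coeff-· (a * b) f k ⟩
    (a * b) * coeff f k       ≈⟨ *-assoc _ _ _ ⟩
    a * (b * coeff f k)       ≈⟨ *-congˡ (coeff-· b f k) ⟨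
    a * coeff (b ·ₚ f) k      ≈⟨ coeff-· a (b ·ₚ f) k ⟨
    coeff (a ·ₚ (b ·ₚ f)) k   ∎

  0·-zero : ∀ f → 0# ·ₚ f ≈ₚ []
  0·-zero f = coeffwise λ k → trans (coeff-· 0# f k) (zeroˡ _)

  1·-identity : ∀ f → 1# ·ₚ f ≈ₚ f
  1·-identity f = coeffwise λ k → trans (coeff-· 1# f k) (*-identityˡ _)

  shift-+ : ∀ f g → 0# ∷ (f +ₚ g) ≈ₚ (0# ∷ f) +ₚ (0# ∷ g)
  shift-+ f g = ∷-cong (sym (+-identityˡ 0#)) ≈ₚ-refl

  shift-* : ∀ f g → (0# ∷ f) *ₚ g ≈ₚ 0# ∷ (f *ₚ g)
  shift-* f g = +ₚ-cong {g = 0# ∷ (f *ₚ g)} (0·-zero g) ≈ₚ-refl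

  *ₚ-zeroʳ : ∀ f → f *ₚ [] ≈ₚ []
  *ₚ-zeroʳ []      = ≈ₚ-refl
  *ₚ-zeroʳ (a ∷ f) = ≈ₚ-trans (∷-cong refl (*ₚ-zeroʳ f)) 0∷[]≈[]

  *ₚ-congˡ : ∀ f {g g′} → g ≈ₚ g′ → f *ₚ g ≈ₚ f *ₚ g′
  *ₚ-congˡ []      e = ≈ₚ-refl
  *ₚ-congˡ (a ∷ f) e = +ₚ-cong (·-cong refl e) (∷-cong refl (*ₚ-congˡ f e))

  *ₚ-∷ : ∀ f b g → f *ₚ (b ∷ g) ≈ₚ b ·ₚ f +ₚ (0# ∷ (f *ₚ g))
  *ₚ-∷ []      b g = ≈ₚ-sym 0∷[]≈[]
  *ₚ-∷ (a ∷ f) b g = ∷-cong (+-congʳ (*-comm a b)) (let open Pₛ in begin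
    a ·ₚ g +ₚ f *ₚ (b ∷ g)                  ≈⟨ +ₚ-cong {a ·ₚ g} ≈ₚ-refl (*ₚ-∷ f b g) ⟩
    a ·ₚ g +ₚ (b ·ₚ f +ₚ (0# ∷ (f *ₚ g)))   ≈⟨ +ₚ-swap (a ·ₚ g) (b ·ₚ f) _ ⟩
    b ·ₚ f +ₚ (a ·ₚ g +ₚ (0# ∷ (f *ₚ g)))   ∎)

  *ₚ-comm : ∀ f g → f *ₚ g ≈ₚ g *ₚ f
  *ₚ-comm []      g = ≈ₚ-sym (*ₚ-zeroʳ g)
  *ₚ-comm (a ∷ f) g = ≈ₚ-trans
    (+ₚ-cong {a ·ₚ g} ≈ₚ-refl (∷-cong refl (*ₚ-comm f g)))
    (≈ₚ-sym (*ₚ-∷ g a f))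

  *ₚ-cong : ∀ {f f′ g g′} → f ≈ₚ f′ → g ≈ₚ g′ → f *ₚ g ≈ₚ f′ *ₚ g′
  *ₚ-cong {f} {f′} {g} {g′} d e = let open Pₛ in begin
    f *ₚ g    ≈⟨ *ₚ-congˡ f e ⟩
    f *ₚ g′   ≈⟨ *ₚ-comm f g′ ⟩
    g′ *ₚ f   ≈⟨ *ₚ-congˡ g′ d ⟩
    g′ *ₚ f′  ≈⟨ *ₚ-comm g′ f′ ⟩
    f′ *ₚ g′  ∎

  *ₚ-distribʳ : ∀ h f g → (f +ₚ g) *ₚ h ≈ₚ f *ₚ h +ₚ g *ₚ h
  *ₚ-distribʳ h []      g       = ≈ₚ-refl
  *ₚ-distribʳ h (a ∷ f) []      = ≈ₚ-sym (+ₚ-identityʳ _)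
  *ₚ-distribʳ h (a ∷ f) (b ∷ g) = let open Pₛ in begin
    (a + b) ·ₚ h +ₚ (0# ∷ ((f +ₚ g) *ₚ h))
      ≈⟨ +ₚ-cong (·-distribʳ a b h) (∷-cong refl (*ₚ-distribʳ h f g)) ⟩
    (a ·ₚ h +ₚ b ·ₚ h) +ₚ (0# ∷ (f *ₚ h +ₚ g *ₚ h))
      ≈⟨ +ₚ-cong {a ·ₚ h +ₚ b ·ₚ h} ≈ₚ-refl (shift-+ (f *ₚ h) (g *ₚ h)) ⟩
    (a ·ₚ h +ₚ b ·ₚ h) +ₚ ((0# ∷ (f *ₚ h)) +ₚ (0# ∷ (g *ₚ h)))
      ≈⟨ +ₚ-interchange (a ·ₚ h) (b ·ₚ h) (0# ∷ (f *ₚ h)) (0# ∷ (g *ₚ h)) ⟩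
    (a ·ₚ h +ₚ (0# ∷ (f *ₚ h))) +ₚ (b ·ₚ h +ₚ (0# ∷ (g *ₚ h)))
      ∎

  *ₚ-distribˡ : ∀ h f g → h *ₚ (f +ₚ g) ≈ₚ h *ₚ f +ₚ h *ₚ g
  *ₚ-distribˡ h f g = let open Pₛ in begin
    h *ₚ (f +ₚ g)     ≈⟨ *ₚ-comm h (f +ₚ g) ⟩
    (f +ₚ g) *ₚ h     ≈⟨ *ₚ-distribʳ h f g ⟩
    f *ₚ h +ₚ g *ₚ h  ≈⟨ +ₚ-cong (*ₚ-comm f h) (*ₚ-comm g h) ⟩
    h *ₚ f +ₚ h *ₚ g  ∎

  ·-*-assoc : ∀ a f g → (a ·ₚ f) *ₚ g ≈ₚ a ·ₚ (f *ₚ g)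
  ·-*-assoc a []      g = ≈ₚ-refl
  ·-*-assoc a (b ∷ f) g = let open Pₛ in begin
    (a * b) ·ₚ g +ₚ (0# ∷ ((a ·ₚ f) *ₚ g))
      ≈⟨ +ₚ-cong (·-·-assoc a b g) (∷-cong (sym (zeroʳ a)) (·-*-assoc a f g)) ⟩
    a ·ₚ (b ·ₚ g) +ₚ a ·ₚ (0# ∷ (f *ₚ g))
      ≈⟨ ·-distribˡ a (b ·ₚ g) (0# ∷ (f *ₚ g)) ⟨
    a ·ₚ (b ·ₚ g +ₚ (0# ∷ (f *ₚ g)))
      ∎

  *ₚ-assoc : ∀ f g h → (f *ₚ g) *ₚ h ≈ₚ f *ₚ (g *ₚ h)
  *ₚ-assoc []      g h = ≈ₚ-refl
  *ₚ-assoc (a ∷ f) g h = let open Pₛ in begin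
    (a ·ₚ g +ₚ (0# ∷ (f *ₚ g))) *ₚ h
      ≈⟨ *ₚ-distribʳ h (a ·ₚ g) (0# ∷ (f *ₚ g)) ⟩
    (a ·ₚ g) *ₚ h +ₚ (0# ∷ (f *ₚ g)) *ₚ h
      ≈⟨ +ₚ-cong (·-*-assoc a g h) (shift-* (f *ₚ g) h) ⟩
    a ·ₚ (g *ₚ h) +ₚ (0# ∷ ((f *ₚ g) *ₚ h))
      ≈⟨ +ₚ-cong {a ·ₚ (g *ₚ h)} ≈ₚ-refl (∷-cong refl (*ₚ-assoc f g h)) ⟩
    a ·ₚ (g *ₚ h) +ₚ (0# ∷ (f *ₚ (g *ₚ h)))
      ∎

  *ₚ-identityˡ : ∀ f → (1# ∷ []) *ₚ f ≈ₚ f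
  *ₚ-identityˡ f = let open Pₛ in begin
    1# ·ₚ f +ₚ (0# ∷ [])  ≈⟨ +ₚ-cong (1·-identity f) 0∷[]≈[] ⟩
    f +ₚ []               ≈⟨ +ₚ-identityʳ f ⟩
    f                     ∎

  *ₚ-identityʳ : ∀ f → f *ₚ (1# ∷ []) ≈ₚ f
  *ₚ-identityʳ f = ≈ₚ-trans (*ₚ-comm f (1# ∷ [])) (*ₚ-identityˡ f)

  polynomialRing : CommutativeRing c ℓ
  polynomialRing = record
    { Carrier = List Carrier
    ; _≈_ = _≈ₚ_
    ; _+_ = _+ₚ_
    ; _*_ = _*ₚ_
    ; -_  = -ₚ_
    ; 0#  = []
    ; 1#  = 1# ∷ []
    ; isCommutativeRing = record
      { isRing = record
        { +-isAbelianGroup = record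
          { isGroup = record
            { isMonoid = record
              { isSemigroup = record
                { isMagma = record
                  { isEquivalence = Setoid.isEquivalence ≈ₚ-setoid
                  ; ∙-cong = +ₚ-cong
                  }
                ; assoc = +ₚ-assoc
                }
              ; identity = (λ _ → ≈ₚ-refl) , +ₚ-identityʳ
              }
            ; inverse = -ₚ-inverseˡ , -ₚ-inverseʳ
            ; ⁻¹-cong = -ₚ-cong
            }
          ; comm = +ₚ-comm
          }
        ; *-cong = *ₚ-cong
        ; *-assoc = *ₚ-assoc
        ; *-identity = *ₚ-identityˡ , *ₚ-identityʳ
        ; distrib = *ₚ-distribˡ , *ₚ-distribʳ
        }
      ; *-comm = *ₚ-comm
      }
    }

-- Multivariate polynomials: R[x₀,…,xₙ₋₁] is the iterated ring
-- R[xₙ₋₁]⋯[x₁][x₀], so the outermost list is in powers of x₀.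

MPoly : CommutativeRing c ℓ → ℕ → CommutativeRing c ℓ
MPoly R zero    = R
MPoly R (suc n) = Univariate.polynomialRing (MPoly R n)

module Multivariate (R : CommutativeRing c ℓ) where
  open CommutativeRing R hiding (zero)

  Poly : ℕ → Set c
  Poly n = CommutativeRing.Carrier (MPoly R n)

  const : ∀ n → Carrier → Poly n
  const zero    a = a
  const (suc n) a = const n a ∷ []

  var : ∀ n → Fin n → Poly n
  var (suc n) zero    = CommutativeRing.0# (MPoly R n) ∷
                        CommutativeRing.1# (MPoly R n) ∷ []
  var (suc n) (suc i) = var n i ∷ []

  eval : ∀ n → Poly n → Vector Carrier n → Carrier
  eval zero    a s = a
  eval (suc n) f s =
    List.foldr (λ g acc → eval n g (Vec.tail s) + Vec.head s * acc) 0# f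

  -- The coefficient of x₀^(m 0) ⋯ xₙ₋₁^(m (n-1)).
  coefficient : ∀ n → Poly n → Vector ℕ n → Carrier
  coefficient zero    a m = a
  coefficient (suc n) f m =
    coefficient n (Univariate.coeff (MPoly R n) f (Vec.head m)) (Vec.tail m)

  degree : ∀ {n} → Vector ℕ n → ℕ
  degree = Vec.foldr ℕ._+_ 0

  HasTotalDegree : ∀ n → Poly n → ℕ → Set ℓ
  HasTotalDegree n f d =
    (∃[ m ] degree m ≡ d × ¬ (coefficient n f m ≈ 0#)) ×
    (∀ m → d ℕ.< degree m → coefficient n f m ≈ 0#)

  DegreeIn< : ∀ n → Poly n → Fin n → ℕ → Set ℓ
  DegreeIn< n f i b = ∀ m → b ℕ.≤ m i → coefficient n f m ≈ 0#

  const-cong : ∀ n {a b} → a ≈ b →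
    CommutativeRing._≈_ (MPoly R n) (const n a) (const n b)
  const-cong zero    e = e
  const-cong (suc n) e = ∷-cong (const-cong n e) ≈ₚ-refl
    where open Univariate (MPoly R n)

  const-0 : ∀ n → CommutativeRing._≈_ (MPoly R n)
    (const n 0#) (CommutativeRing.0# (MPoly R n))
  const-0 zero    = refl
  const-0 (suc n) = ≈ₚ-trans (∷-cong (const-0 n) ≈ₚ-refl) 0∷[]≈[]
    where open Univariate (MPoly R n)

  const-1 : ∀ n → CommutativeRing._≈_ (MPoly R n)
    (const n 1#) (CommutativeRing.1# (MPoly R n))
  const-1 zero    = refl
  const-1 (suc n) = ∷-cong (const-1 n) ≈ₚ-refl
    where open Univariate (MPoly R n)

  const-+ : ∀ n a b → CommutativeRing._≈_ (MPoly R n)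
    (const n (a + b)) (CommutativeRing._+_ (MPoly R n) (const n a) (const n b))
  const-+ zero    a b = refl
  const-+ (suc n) a b = ∷-cong (const-+ n a b) ≈ₚ-refl
    where open Univariate (MPoly R n)

  const-* : ∀ n a b → CommutativeRing._≈_ (MPoly R n)
    (const n (a * b)) (CommutativeRing._*_ (MPoly R n) (const n a) (const n b))
  const-* zero    a b = refl
  const-* (suc n) a b =
    ∷-cong (P.trans (const-* n a b) (P.sym (P.+-identityʳ _))) ≈ₚ-refl
    where
    open Univariate (MPoly R n)
    module P = CommutativeRing (MPoly R n)

module RingOps (A : CommutativeRing c ℓ) where
  open RawSemiringOps (Semiring.rawSemiring (CommutativeRing.semiring A)) public
    using (_^_; sum; product)

record Ideal (A : CommutativeRing c ℓ) (p : Level) : Set (c ⊔ ℓ ⊔ Level.suc p) where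
  open CommutativeRing A hiding (zero)
  field
    Member   : Pred Carrier p
    resp-≈   : ∀ {x y} → x ≈ y → Member x → Member y
    0∈       : Member 0#
    +-closed : ∀ {x y} → Member x → Member y → Member (x + y)
    *-closed : ∀ r {x} → Member x → Member (r * x)

module Ideals (A : CommutativeRing c ℓ) where
  open CommutativeRing A hiding (zero)
  open RingOps A using (_^_)
  open CommutativeSemigroupProps
    (CommutativeRing.+-commutativeSemigroup A) using (interchange)

  infix 4 _∈_
  _∈_ : Carrier → Ideal A p → Set p
  x ∈ I = Ideal.Member I x

  data Generated {G : Set ι} (g : G → Carrier) : Pred Carrier (c ⊔ ℓ ⊔ ι) where
    gen  : ∀ i → Generated g (g i)
    resp : ∀ {x y} → x ≈ y → Generated g x → Generated g y
    nil  : Generated g 0#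
    add  : ∀ {x y} → Generated g x → Generated g y → Generated g (x + y)
    mul  : ∀ r {x} → Generated g x → Generated g (r * x)

  ⟨_⟩ : {G : Set ι} → (G → Carrier) → Ideal A (c ⊔ ℓ ⊔ ι)
  ⟨ g ⟩ = record
    { Member = Generated g
    ; resp-≈ = resp
    ; 0∈ = nil
    ; +-closed = add
    ; *-closed = mul
    }

  infixl 6 _⊕_
  _⊕_ : Ideal A p → Ideal A p′ → Ideal A (c ⊔ ℓ ⊔ p ⊔ p′)
  I ⊕ J = record
    { Member = λ x → ∃₂ λ y z → y ∈ I × z ∈ J × x ≈ y + z
    ; resp-≈ = λ { x≈x′ (y , z , y∈ , z∈ , e) →
        y , z , y∈ , z∈ , trans (sym x≈x′) e }
    ; 0∈ = 0# , 0# , I.0∈ , J.0∈ , sym (+-identityˡ 0#)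
    ; +-closed = λ { (y , z , y∈ , z∈ , e) (y′ , z′ , y′∈ , z′∈ , e′) →
        y + y′ , z + z′ , I.+-closed y∈ y′∈ , J.+-closed z∈ z′∈ ,
        trans (+-cong e e′) (interchange _ _ _ _) }
    ; *-closed = λ { r (y , z , y∈ , z∈ , e) →
        r * y , r * z , I.*-closed r y∈ , J.*-closed r z∈ ,
        trans (*-congˡ e) (distribˡ _ _ _) }
    }
    where
    module I = Ideal I
    module J = Ideal J

  IsRadical : Ideal A p → Set (c ⊔ p)
  IsRadical I = ∀ x k → x ^ k ∈ I → x ∈ I

module _ {R : CommutativeRing c ℓ} (M : Module R m ℓm) where
  open CommutativeRing R using (Carrier; _≈_; 0#)
  open Module M
  open RawMonoidOps +ᴹ-rawMonoid using (sum)

  linearCombination : ∀ {k} → Vector Carrier k → Vector Carrierᴹ k → Carrierᴹ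
  linearCombination a v = sum λ i → a i *ₗ v i

  record IsBasis {k} (v : Vector Carrierᴹ k) : Set (c ⊔ ℓ ⊔ m ⊔ ℓm) where
    field
      independent : ∀ a → linearCombination a v ≈ᴹ 0ᴹ → ∀ i → a i ≈ 0#
      spanning    : ∀ x → ∃[ a ] x ≈ᴹ linearCombination a v

  HasDimension : ℕ → Set (c ⊔ ℓ ⊔ m ⊔ ℓm)
  HasDimension k = Σ (Vector Carrierᴹ k) IsBasis

  IsFiniteDimensional : Set (c ⊔ ℓ ⊔ m ⊔ ℓm)
  IsFiniteDimensional = ∃ HasDimension

subsetoid : (S : Setoid c ℓ) → Pred (Setoid.Carrier S) p → Setoid (c ⊔ p) ℓ
subsetoid S P = On.setoid S (proj₁ {B = P})

module _ (R : CommutativeRing c ℓ) (n : ℕ) (I : Ideal (MPoly R n) p) where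
  open Multivariate R using (eval; const; const-cong; const-0; const-1; const-+; const-*)
  private
    module R = CommutativeRing R
    module I = Ideal I
  open Ideals (MPoly R n) using (_∈_)
  open CommutativeRing (MPoly R n) hiding (zero)
  open AbelianGroupProps +-abelianGroup using (⁻¹-∙-comm)
  open RingProps ring using (-‿distribʳ-*; -1*x≈-x; -‿involutive)
  open CommutativeSemigroupProps
    (CommutativeRing.+-commutativeSemigroup (MPoly R n)) using (interchange)

  𝒵 : Setoid (c ⊔ ℓ ⊔ p) ℓ
  𝒵 = subsetoid (Pointwise.setoid R.setoid n)
                λ s → ∀ f → f ∈ I → eval n f s R.≈ R.0#

  infix 4 _∼_
  record _∼_ (f g : Carrier) : Set p where
    constructor modulo
    field difference∈ : f - g ∈ I
  open _∼_

  -∈ : ∀ {f} → f ∈ I → - f ∈ I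
  -∈ f∈ = I.resp-≈ (-1*x≈-x _) (I.*-closed (- 1#) f∈)

  ∼-reflexive : ∀ {f g} → f ≈ g → f ∼ g
  ∼-reflexive {f} {g} e =
    modulo (I.resp-≈ (trans (sym (-‿inverseʳ g)) (+-congʳ (sym e))) I.0∈)

  ∼-sym : ∀ {f g} → f ∼ g → g ∼ f
  ∼-sym {f} {g} (modulo e) = modulo (I.resp-≈ eq (-∈ e))
    where
    eq : - (f - g) ≈ g - f
    eq = trans (sym (⁻¹-∙-comm f (- g)))
           (trans (+-congˡ (-‿involutive g)) (+-comm (- f) g))

  ∼-trans : ∀ {f g h} → f ∼ g → g ∼ h → f ∼ h
  ∼-trans {f} {g} {h} (modulo d) (modulo e) = modulo (I.resp-≈ eq (I.+-closed d e))
    where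
    open SetoidReasoning setoid
    eq : (f - g) + (g - h) ≈ f - h
    eq = begin
      (f - g) + (g - h)    ≈⟨ +-assoc f (- g) (g - h) ⟩
      f + (- g + (g - h))  ≈⟨ +-congˡ (+-assoc (- g) g (- h)) ⟨
      f + ((- g + g) - h)  ≈⟨ +-congˡ (+-congʳ (-‿inverseˡ g)) ⟩
      f + (0# - h)         ≈⟨ +-congˡ (+-identityˡ (- h)) ⟩
      f - h                ∎

  ∼-+ : ∀ {f f′ g g′} → f ∼ f′ → g ∼ g′ → (f + g) ∼ (f′ + g′)
  ∼-+ {f} {f′} {g} {g′} (modulo d) (modulo e) = modulo (I.resp-≈ eq (I.+-closed d e))
    where
    eq : (f - f′) + (g - g′) ≈ (f + g) - (f′ + g′)
    eq = trans (interchange f (- f′) g (- g′)) (+-congˡ (⁻¹-∙-comm f′ g′))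

  ∼-*ˡ : ∀ r {f g} → f ∼ g → (r * f) ∼ (r * g)
  ∼-*ˡ r {f} {g} (modulo d) = modulo (I.resp-≈ eq (I.*-closed r d))
    where
    eq : r * (f - g) ≈ r * f - r * g
    eq = trans (distribˡ r f (- g)) (+-congˡ (sym (-‿distribʳ-* r g)))

  ∼-neg : ∀ {f g} → f ∼ g → (- f) ∼ (- g)
  ∼-neg {f} {g} (modulo d) = modulo (I.resp-≈ (sym (⁻¹-∙-comm f (- g))) (-∈ d))

  -- The R-module underlying the quotient ring R[x₀,…,xₙ₋₁]/I: its equality
  -- is congruence modulo I.
  quotient : Module R c p
  quotient = record
    { Carrierᴹ = Carrier
    ; _≈ᴹ_ = _∼_
    ; _+ᴹ_ = _+_
    ; _*ₗ_ = λ a f → const n a * f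
    ; _*ᵣ_ = λ f a → const n a * f
    ; 0ᴹ = 0#
    ; -ᴹ_ = -_
    ; isModule = IsModuleFromLeft.isModule {commutativeRing = R} record
      { isLeftModule = record
        { isLeftSemimodule = record
          { +ᴹ-isCommutativeMonoid = record
            { isMonoid = record
              { isSemigroup = record
                { isMagma = record
                  { isEquivalence = record
                    { refl = ∼-reflexive refl ; sym = ∼-sym ; trans = ∼-trans }
                  ; ∙-cong = ∼-+
                  }
                ; assoc = λ f g h → ∼-reflexive (+-assoc f g h)
                }
              ; identity = (λ f → ∼-reflexive (+-identityˡ f))
                         , (λ f → ∼-reflexive (+-identityʳ f))
              }
            ; comm = λ f g → ∼-reflexive (+-comm f g)
            }
          ; isPreleftSemimodule = record
            { *ₗ-cong = λ {_} {b} {f} a≈b f∼g →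
                ∼-trans (∼-reflexive (*-congʳ (const-cong n a≈b))) (∼-*ˡ (const n b) f∼g)
            ; *ₗ-zeroˡ = λ f → ∼-reflexive (trans (*-congʳ (const-0 n)) (zeroˡ f))
            ; *ₗ-distribʳ = λ f a b →
                ∼-reflexive (trans (*-congʳ (const-+ n a b)) (distribʳ f _ _))
            ; *ₗ-identityˡ = λ f →
                ∼-reflexive (trans (*-congʳ (const-1 n)) (*-identityˡ f))
            ; *ₗ-assoc = λ a b f →
                ∼-reflexive (trans (*-congʳ (const-* n a b)) (*-assoc _ _ f))
            ; *ₗ-zeroʳ = λ a → ∼-reflexive (zeroʳ (const n a))
            ; *ₗ-distribˡ = λ a f g → ∼-reflexive (distribˡ (const n a) f g)
            }
          }
        ; -ᴹ‿cong = ∼-neg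
        ; -ᴹ‿inverse = (λ f → ∼-reflexive (-‿inverseˡ f))
                     , (λ f → ∼-reflexive (-‿inverseʳ f))
        }
      }
    }

  IsZeroDimensional : Set (c ⊔ ℓ ⊔ p)
  IsZeroDimensional = IsFiniteDimensional quotient

-- The indices 0 ≤ i ≤ q-2 are the elements of Fin (q ∸ 1).

module OverFiniteField {q : ℕ} (F : FiniteField c ℓ q) where
  open FiniteField F hiding (zero)
  open Multivariate commutativeRing
  open RingOps commutativeRing using (_^_)

  module Ops (n : ℕ) where
    open CommutativeRing (MPoly commutativeRing n) public
      using () renaming (_*_ to _⊛_; _-_ to _⊝_; 1# to 1ₚ)
    open RingOps (MPoly commutativeRing n) public
      using (sum; product) renaming (_^_ to _⊛^_)
    open Ideals (MPoly commutativeRing n) public using (⟨_⟩; _⊕_)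

    F⟦_⟧ : Poly n → Poly n
    F⟦ g ⟧ = g ⊛^ (q ℕ.∸ 1) ⊝ 1ₚ

  IsPermutationPolynomial : Pred (Poly 1) (c ⊔ ℓ)
  IsPermutationPolynomial f =
    DegreeIn< 1 f zero q ×
    Bijective _≈_ _≈_ (λ a → eval 1 f (a Vec.∷ Vec.[]))

  𝒫 : ℕ → Setoid (c ⊔ ℓ) ℓ
  𝒫 d = subsetoid (CommutativeRing.setoid (MPoly commutativeRing 1))
    λ f → IsPermutationPolynomial f × HasTotalDegree 1 f d

  -- The variables x and y of F[x,y] are zero and suc zero : Fin 2.

  IsLocalPermutationPolynomial : Pred (Poly 2) (c ⊔ ℓ)
  IsLocalPermutationPolynomial f =
    DegreeIn< 2 f zero q ×
    DegreeIn< 2 f (suc zero) q ×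
    (∀ a → Bijective _≈_ _≈_ (λ x → eval 2 f (x Vec.∷ a Vec.∷ Vec.[])) ×
           Bijective _≈_ _≈_ (λ y → eval 2 f (a Vec.∷ y Vec.∷ Vec.[])))

  ℒ𝒫 : ℕ → Setoid (c ⊔ ℓ) ℓ
  ℒ𝒫 d = subsetoid (CommutativeRing.setoid (MPoly commutativeRing 2))
    λ f → IsLocalPermutationPolynomial f × HasTotalDegree 2 f d

  univariatePoly : Vector Carrier (q ℕ.∸ 1) → Poly 1
  univariatePoly s = sum λ (i : Fin (q ℕ.∸ 1)) → const 1 (s i) ⊛ x ⊛^ toℕ i
    where
    open Ops 1 using (_⊛_; _⊛^_; sum)
    x = var 1 zero

  -- The point (sᵢⱼ) is stored as a vector with sᵢⱼ in position combine i j.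
  bivariatePoly : Vector Carrier ((q ℕ.∸ 1) ℕ.* (q ℕ.∸ 1)) → Poly 2
  bivariatePoly s =
    sum λ (i : Fin (q ℕ.∸ 1)) → sum λ (j : Fin (q ℕ.∸ 1)) →
      const 2 (s (combine i j)) ⊛ (x ⊛^ toℕ i ⊛ y ⊛^ toℕ j)
    where
    open Ops 2 using (_⊛_; _⊛^_; sum)
    x = var 2 zero
    y = var 2 (suc zero)

  Distinct : Set (c ⊔ ℓ)
  Distinct = Σ (Carrier × Carrier) λ (a , b) → ¬ (a ≈ b)

  nX : ℕ
  nX = q ℕ.∸ 1

  module _ where
    open Ops nX

    private
      x : Fin nX → Poly nX
      x = var nX

    Fgen : Distinct → Poly nX
    Fgen ((a , b) , _) =
      F⟦ sum (λ i → const nX (a ^ toℕ i - b ^ toℕ i) ⊛ x i) ⟧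

    ℐ : Ideal (MPoly commutativeRing nX) (c ⊔ ℓ)
    ℐ = ⟨ Fgen ⟩ ⊕ ⟨ (λ i → x i ⊛^ q ⊝ x i) ⟩

    ℐ[_] : Fin nX → Ideal (MPoly commutativeRing nX) (c ⊔ ℓ)
    ℐ[ d ] = ℐ
      ⊕ ⟨ (λ ((i , _) : ∃[ i ] toℕ d ℕ.< toℕ i) → x i) ⟩
      ⊕ ⟨ (λ (_ : ⊤) → F⟦ x d ⟧) ⟩

  nX̄ : ℕ
  nX̄ = (q ℕ.∸ 1) ℕ.* (q ℕ.∸ 1)

  module _ where
    open Ops nX̄

    private
      x : Fin (q ℕ.∸ 1) → Fin (q ℕ.∸ 1) → Poly nX̄
      x i j = var nX̄ (combine i j)

    -- The sum in Grow runs over xⱼᵢ, the one in Gcol over xᵢⱼ.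
    Grow Gcol : Distinct × Carrier → Poly nX̄
    Grow (((a , b) , _) , e) = F⟦ sum (λ i → sum λ j →
      const nX̄ ((a ^ toℕ i - b ^ toℕ i) * e ^ toℕ j) ⊛ x j i) ⟧
    Gcol (((a , b) , _) , e) = F⟦ sum (λ i → sum λ j →
      const nX̄ ((a ^ toℕ i - b ^ toℕ i) * e ^ toℕ j) ⊛ x i j) ⟧

    𝒥 : Ideal (MPoly commutativeRing nX̄) (c ⊔ ℓ)
    𝒥 = ⟨ [ Grow , Gcol ] ⟩ ⊕ ⟨ (λ ((i , j) : Fin (q ℕ.∸ 1) × Fin (q ℕ.∸ 1)) →
      x i j ⊛^ q ⊝ x i j) ⟩

    -- The product of F(xᵢⱼ) over i + j = d; all other factors are 1.
    topProduct : ℕ → Poly nX̄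
    topProduct d = product λ i → product λ j →
      if does (toℕ i ℕ.+ toℕ j ℕ.≟ d) then F⟦ x i j ⟧ else 1ₚ

    𝒥[_] : ℕ → Ideal (MPoly commutativeRing nX̄) (c ⊔ ℓ)
    𝒥[ d ] = 𝒥
      ⊕ ⟨ (λ ((i , j , _) : ∃₂ λ i j → d ℕ.< toℕ i ℕ.+ toℕ j) → x i j) ⟩
      ⊕ ⟨ (λ (_ : ⊤) → topProduct d) ⟩

≤q-2⇒<q-1 : ∀ {q d} → 3 ℕ.< q → d ℕ.≤ q ℕ.∸ 2 → d ℕ.< q ℕ.∸ 1
≤q-2⇒<q-1 (s≤s (s≤s _)) d≤q-2 = s≤s d≤q-2

-- Every ideal I of F[x₁,…,xₙ] that contains all xᵢ^q − xᵢ and whose zeros can be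
-- decided contains every polynomial vanishing on 𝒵 I: a polynomial vanishing on
-- all of Fⁿ lies in ⟨xᵢ^q − xᵢ⟩ (divide by x₁^q − x₁ and recurse on the
-- coefficients), and away from 𝒵 I a suitable element of I times the indicator
-- of a point corrects the values of a polynomial one point at a time.  So I is
-- radical, and the indicators of the zeros form a basis of the quotient.
--
-- By Fermat, F⟦ g ⟧ vanishes exactly where g does not, so the generators of ℐ
-- and 𝒥 say that the evaluation maps are injective, hence bijective.  Conversely
-- a (local) permutation polynomial has no term of degree q − 1 in a variable:
-- up to sign the coefficient of x^(q−1) is Σ f(x) = Σ x, and this is 0 as q > 2.

module Submission where

open import Defs
open import Data.Fin.Base using (fromℕ<)
open import Data.Nat.Base using (ℕ; _<_; _≤_; _∸_)
open import Data.Product.Base using (Σ-syntax; ∃-syntax; _×_; proj₁)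
open import Function.Bundles using (Bijection)
open import Algebra.Bundles using (CommutativeRing)
open import Algebra.Bundles using (CommutativeMonoid)
open import Algebra.Morphism.Structures using (IsRingHomomorphism)
import Algebra.Properties.CommutativeMonoid.Sum as CommutativeMonoidSum
import Algebra.Properties.CommutativeSemiring.Exp as CommutativeSemiringExp
import Algebra.Properties.Ring as RingProperties
import Algebra.Properties.Semiring.Sum as Sum
import Algebra.Solver.Ring.NaturalCoefficients.Default as SemiringSolver
open import Data.Bool.Base using (if_then_else_)
open import Data.Fin.Base as Fin
  using (Fin; zero; suc; toℕ; punchIn; punchOut; funToFin; finToFun; combine; remQuot)
import Data.Fin.Permutation as Permutation
import Data.Fin.Properties as Fin
open import Data.List.Base as List using (List; []; _∷_; length)
import Data.List.Properties as List
open import Data.Nat.Base as ℕ using (zero; suc; z≤n; s≤s)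
import Data.Nat.Properties as ℕ
open import Data.Product.Base using (∃; ∃₂; _,_; proj₂)
open import Data.Sum.Base using (_⊎_; inj₁; inj₂; [_,_])
open import Data.Unit.Base using (⊤; tt)
open import Data.Vec.Functional as Vec using (Vector)
import Data.Vec.Functional.Relation.Binary.Pointwise.Properties as Pointwise
open import Function.Base using (_∘_; id; flip)
open import Function.Bundles using (Inverse)
import Function.Construct.Composition as Composition
import Function.Construct.Symmetry as Symmetry
open import Function.Definitions using (Injective; Surjective; Congruent)
open import Function.Properties.Bijection using (Bijection⇒Inverse)
open import Level using (Level; _⊔_)
open import Relation.Binary.Bundles using (Setoid)
open import Relation.Binary.PropositionalEquality as ≡ using (_≡_; _≢_)
import Relation.Binary.Reasoning.Setoid as SetoidReasoning
open import Relation.Nullary using (¬_; Dec; yes; no; does; contradiction; _×-dec_; _⊎-dec_; ¬?)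
import Relation.Nullary.Decidable as Dec
open import Relation.Unary using (Pred; Decidable)

-- A zero of an ideal is a point killed by every member, and members are closed under arbitrary
-- multiples, so being a zero is not decidable from its definition. The proof therefore carries a
-- dichotomy for each point: either the whole ideal vanishes there, or a member with nonzero value
-- is exhibited. It is obtained from the generators, where it becomes a finite search through the
-- field. It is used twice: to count the zeros, and to correct a polynomial at a point, which
-- divides by the exhibited value.
--
-- That Σ x^k = 0 for 0 < k < q - 1 is often read off a generator of the multiplicative group. Here
-- one nonzero g with g^k ≠ 1 is enough, and bounding the number of roots of X^(k+1) - X provides
-- it. For k = 0 the sum is q times 1, and the translation x ↦ x + 1 shows that it is 0.
--
-- In two variables the coefficient of x^(q-1) is a polynomial in y. The argument in one variable
-- makes it vanish at every value of y, and as its degree in y is below q, all its coefficients are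
-- 0.

private
  variable
    a b c ℓ p ι ℓ₁ ℓ₂ : Level

-- Homomorphisms, evaluation and division

infix 4 _⟶_∋_
_⟶_∋_ : (S : CommutativeRing a ℓ₁) (R : CommutativeRing b ℓ₂) →
        (CommutativeRing.Carrier S → CommutativeRing.Carrier R) → Set _
S ⟶ R ∋ φ =
  IsRingHomomorphism (CommutativeRing.rawRing S) (CommutativeRing.rawRing R) φ

module _ (S : CommutativeRing a ℓ₁) (R : CommutativeRing b ℓ₂) where
  private
    module S = CommutativeRing S
    module R = CommutativeRing R
  open RingProperties R.ring using (+-identityˡ-unique; +-inverseˡ-unique)

  -- Zero and negation come from additivity: φ(0) + φ(0) = φ(0) forces φ(0) = 0, and additive
  -- inverses are unique.
  mkHom : ∀ {φ} →
          (∀ {x y} → x S.≈ y → φ x R.≈ φ y) →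
          (∀ x y → φ (x S.+ y) R.≈ φ x R.+ φ y) →
          (∀ x y → φ (x S.* y) R.≈ φ x R.* φ y) →
          φ S.1# R.≈ R.1# →
          S ⟶ R ∋ φ
  mkHom {φ} cong +-homo *-homo 1-homo = record
    { isSemiringHomomorphism = record
      { isNearSemiringHomomorphism = record
        { +-isMonoidHomomorphism = record
          { isMagmaHomomorphism = record
            { isRelHomomorphism = record { cong = cong } ; homo = +-homo }
          ; ε-homo = 0-homo
          }
        ; *-homo = *-homo
        }
      ; 1#-homo = 1-homo
      }
    ; -‿homo = λ x → +-inverseˡ-unique _ _
        (R.trans (R.sym (+-homo _ _)) (R.trans (cong (S.-‿inverseˡ x)) 0-homo))
    }
    where
    0-homo : φ S.0# R.≈ R.0#
    0-homo = +-identityˡ-unique _ _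
      (R.trans (R.sym (+-homo _ _)) (cong (S.+-identityˡ S.0#)))

module Homomorphism (S : CommutativeRing a ℓ₁) (R : CommutativeRing b ℓ₂)
  {φ : CommutativeRing.Carrier S → CommutativeRing.Carrier R} (hom : S ⟶ R ∋ φ) where
  private
    module S = CommutativeRing S
    module R = CommutativeRing R
    module SO = RingOps S
    module RO = RingOps R
  open IsRingHomomorphism hom public
    using (+-homo; *-homo; 1#-homo; 0#-homo; -‿homo; ⟦⟧-cong)

  ^-homo : ∀ x k → φ (x SO.^ k) R.≈ φ x RO.^ k
  ^-homo x zero    = 1#-homo
  ^-homo x (suc k) = R.trans (*-homo _ _) (R.*-congˡ (^-homo x k))

  ∸-homo : ∀ x y → φ (x S.- y) R.≈ φ x R.- φ y
  ∸-homo x y = R.trans (+-homo _ _) (R.+-congˡ (-‿homo y))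

  sum-homo : ∀ {n} (v : Vector S.Carrier n) → φ (SO.sum v) R.≈ RO.sum (φ ∘ v)
  sum-homo {zero}  v = 0#-homo
  sum-homo {suc n} v = R.trans (+-homo _ _) (R.+-congˡ (sum-homo (Vec.tail v)))

  product-homo : ∀ {n} (v : Vector S.Carrier n) →
                 φ (SO.product v) R.≈ RO.product (φ ∘ v)
  product-homo {zero}  v = 1#-homo
  product-homo {suc n} v = R.trans (*-homo _ _) (R.*-congˡ (product-homo (Vec.tail v)))

module Horner (S : CommutativeRing a ℓ₁) (R : CommutativeRing b ℓ₂)
  {φ : CommutativeRing.Carrier S → CommutativeRing.Carrier R} (hom : S ⟶ R ∋ φ)
  (h : CommutativeRing.Carrier R) where
  private
    module S = CommutativeRing S
  open CommutativeRing R hiding (zero)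
  open Homomorphism S R hom
  open Univariate S
  open SetoidReasoning setoid
  open SemiringSolver commutativeSemiring

  -- Shaped to coincide definitionally with the fold in `eval`, so that `eval-hom` iterates
  -- `horner-hom` one variable at a time, with φ the evaluation of the remaining variables.
  horner : List S.Carrier → Carrier
  horner = List.foldr (λ g acc → φ g + h * acc) 0#

  -- Equal polynomials may be lists of different lengths; this settles the cases of `horner-cong`
  -- where one list ends first.
  horner-zero : ∀ f → f ≈ₚ [] → horner f ≈ 0#
  horner-zero []      e = refl
  horner-zero (g ∷ f) e = begin
    φ g + h * horner f  ≈⟨ +-cong (⟦⟧-cong (coeff-≈ e 0))
                            (*-congˡ (horner-zero f (coeffwise (coeff-≈ e ∘ suc)))) ⟩
    φ S.0# + h * 0#     ≈⟨ +-cong 0#-homo (zeroʳ h) ⟩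
    0# + 0#             ≈⟨ +-identityˡ 0# ⟩
    0#                  ∎

  horner-cong : ∀ f g → f ≈ₚ g → horner f ≈ horner g
  horner-cong []      g       e = sym (horner-zero g (≈ₚ-sym e))
  horner-cong (x ∷ f) []      e = horner-zero (x ∷ f) e
  horner-cong (x ∷ f) (y ∷ g) e =
    +-cong (⟦⟧-cong (coeff-≈ e 0)) (*-congˡ (horner-cong f g (coeffwise (coeff-≈ e ∘ suc))))

  horner-+ : ∀ f g → horner (f +ₚ g) ≈ horner f + horner g
  horner-+ []      g       = sym (+-identityˡ _)
  horner-+ (x ∷ f) []      = sym (+-identityʳ _)
  horner-+ (x ∷ f) (y ∷ g) = begin
    φ (x S.+ y) + h * horner (f +ₚ g)          ≈⟨ +-cong (+-homo x y) (*-congˡ (horner-+ f g)) ⟩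
    (φ x + φ y) + h * (horner f + horner g)    ≈⟨ solve 5 (λ x y h f g →
      (x :+ y) :+ h :* (f :+ g) := (x :+ h :* f) :+ (y :+ h :* g)) refl _ _ _ _ _ ⟩
    (φ x + h * horner f) + (φ y + h * horner g) ∎

  horner-· : ∀ c f → horner (c ·ₚ f) ≈ φ c * horner f
  horner-· c []      = sym (zeroʳ _)
  horner-· c (x ∷ f) = begin
    φ (c S.* x) + h * horner (c ·ₚ f)    ≈⟨ +-cong (*-homo c x) (*-congˡ (horner-· c f)) ⟩
    φ c * φ x + h * (φ c * horner f)     ≈⟨ solve 4 (λ c x h f →
      c :* x :+ h :* (c :* f) := c :* (x :+ h :* f)) refl _ _ _ _ ⟩
    φ c * (φ x + h * horner f)           ∎

  horner-* : ∀ f g → horner (f *ₚ g) ≈ horner f * horner g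
  horner-* []      g = sym (zeroˡ _)
  horner-* (x ∷ f) g = begin
    horner (x ·ₚ g +ₚ (S.0# ∷ f *ₚ g))                  ≈⟨ horner-+ (x ·ₚ g) _ ⟩
    horner (x ·ₚ g) + (φ S.0# + h * horner (f *ₚ g))    ≈⟨ +-cong (horner-· x g)
                                                                (+-cong 0#-homo (*-congˡ (horner-* f g))) ⟩
    φ x * horner g + (0# + h * (horner f * horner g))   ≈⟨ solve 4 (λ x g h f →
      x :* g :+ (con 0 :+ h :* (f :* g)) := (x :+ h :* f) :* g) refl _ _ _ _ ⟩
    (φ x + h * horner f) * horner g                     ∎

  horner-∷[] : ∀ g → horner (g ∷ []) ≈ φ g
  horner-∷[] g = trans (+-congˡ (zeroʳ h)) (+-identityʳ _)

  horner-hom : polynomialRing ⟶ R ∋ horner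
  horner-hom = mkHom polynomialRing R (horner-cong _ _) horner-+ horner-*
    (trans (horner-∷[] S.1#) 1#-homo)

module MultivariateEvaluation (R : CommutativeRing a ℓ₁) where
  open CommutativeRing R hiding (zero)
  open Multivariate R

  eval-hom : ∀ n (s : Vector Carrier n) → MPoly R n ⟶ R ∋ (λ f → eval n f s)
  eval-hom zero    s = mkHom R R id (λ _ _ → refl) (λ _ _ → refl) refl
  eval-hom (suc n) s = Horner.horner-hom (MPoly R n) R (eval-hom n (Vec.tail s)) (Vec.head s)

  eval-const : ∀ n c s → eval n (const n c) s ≈ c
  eval-const zero    c s = refl
  eval-const (suc n) c s =
    trans (Horner.horner-∷[] (MPoly R n) R (eval-hom n (Vec.tail s)) (Vec.head s) (const n c))
          (eval-const n c (Vec.tail s))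

  eval-var : ∀ n i s → eval n (var n i) s ≈ s i
  eval-var (suc n) (suc i) s =
    trans (Horner.horner-∷[] (MPoly R n) R (eval-hom n (Vec.tail s)) (Vec.head s) (var n i))
          (eval-var n i (Vec.tail s))
  eval-var (suc n) zero s = begin
    eval n P.0# t + s zero * (eval n P.1# t + s zero * 0#)
      ≈⟨ +-cong 0#-homo (*-congˡ (+-cong 1#-homo (zeroʳ _))) ⟩
    0# + s zero * (1# + 0#)
      ≈⟨ +-identityˡ _ ⟩
    s zero * (1# + 0#)
      ≈⟨ *-congˡ (+-identityʳ _) ⟩
    s zero * 1#
      ≈⟨ *-identityʳ _ ⟩
    s zero ∎
    where
    t = Vec.tail s
    module P = CommutativeRing (MPoly R n)
    open Homomorphism (MPoly R n) R (eval-hom n t)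
    open SetoidReasoning setoid

  eval-cong-point : ∀ n f {s t : Vector Carrier n} → (∀ i → s i ≈ t i) →
                    eval n f s ≈ eval n f t
  eval-cong-point zero    f       e = refl
  eval-cong-point (suc n) []      e = refl
  eval-cong-point (suc n) (g ∷ f) e =
    +-cong (eval-cong-point n g (e ∘ suc)) (*-cong (e zero) (eval-cong-point (suc n) f e))

module UnivariateProperties (S : CommutativeRing a ℓ₁) where
  open CommutativeRing S hiding (zero)
  open Univariate S
  private
    module P = CommutativeRing polynomialRing
  open RingOps polynomialRing using (_^_; sum)
  open Sum P.semiring using (sum-cong-≋; *-distribˡ-sum)
  open SemiringSolver P.commutativeSemiring
  open SetoidReasoning P.setoid

  X : List Carrier
  X = 0# ∷ 1# ∷ []

  constant-hom : S ⟶ polynomialRing ∋ (_∷ [])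
  constant-hom = mkHom S polynomialRing (λ e → ∷-cong e P.refl) (λ _ _ → P.refl)
    (λ x y → ∷-cong (sym (+-identityʳ _)) P.refl) P.refl

  X*≈0∷ : ∀ f → X *ₚ f ≈ₚ 0# ∷ f
  X*≈0∷ f = P.trans (shift-* (1# ∷ []) f) (∷-cong refl (*ₚ-identityˡ f))

  ∷≈+X* : ∀ c f → c ∷ f ≈ₚ (c ∷ []) +ₚ X *ₚ f
  ∷≈+X* c f = P.trans (∷-cong (sym (+-identityʳ c)) P.refl)
                      (+ₚ-cong {c ∷ []} P.refl (P.sym (X*≈0∷ f)))

  -- Every term after the first has a factor X, which is pulled out of the sum. This lets the
  -- polynomial of a point be handled as a plain list of coefficients.
  sum-monomials : ∀ {n} (s : Vector Carrier n) →
                  sum (λ i → (s i ∷ []) *ₚ X ^ toℕ i) ≈ₚ List.tabulate s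
  sum-monomials {zero}  s = P.refl
  sum-monomials {suc n} s = begin
    (s zero ∷ []) *ₚ P.1# +ₚ sum (λ i → (s (suc i) ∷ []) *ₚ (X *ₚ X ^ toℕ i))
      ≈⟨ P.+-cong (P.*-identityʳ (s zero ∷ [])) (sum-cong-≋ (λ i →
           solve 3 (λ c x y → c :* (x :* y) := x :* (c :* y)) P.refl (s (suc i) ∷ []) X (X ^ toℕ i))) ⟩
    (s zero ∷ []) +ₚ sum (λ i → X *ₚ ((s (suc i) ∷ []) *ₚ X ^ toℕ i))
      ≈⟨ P.+-congˡ {s zero ∷ []} (*-distribˡ-sum X (λ i → (s (suc i) ∷ []) *ₚ X ^ toℕ i)) ⟨
    (s zero ∷ []) +ₚ X *ₚ sum (λ i → (s (suc i) ∷ []) *ₚ X ^ toℕ i)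
      ≈⟨ P.+-congˡ {s zero ∷ []} (P.*-congˡ {X} (sum-monomials (s ∘ suc))) ⟩
    (s zero ∷ []) +ₚ X *ₚ List.tabulate (s ∘ suc)
      ≈⟨ ∷≈+X* (s zero) _ ⟨
    s zero ∷ List.tabulate (s ∘ suc) ∎

  coeff-tabulate : ∀ {n} (s : Vector Carrier n) i → coeff (List.tabulate s) (toℕ i) ≈ s i
  coeff-tabulate {suc n} s zero    = refl
  coeff-tabulate {suc n} s (suc i) = coeff-tabulate (s ∘ suc) i

  coeff-tabulate-≥ : ∀ {n} (s : Vector Carrier n) {k} → n ℕ.≤ k → coeff (List.tabulate s) k ≈ 0#
  coeff-tabulate-≥ {zero}  s _       = refl
  coeff-tabulate-≥ {suc n} s (s≤s l) = coeff-tabulate-≥ (s ∘ suc) l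

  tabulate-coeff : ∀ n f → (∀ k → n ℕ.≤ k → coeff f k ≈ 0#) →
                   f ≈ₚ List.tabulate {n = n} (λ i → coeff f (toℕ i))
  tabulate-coeff zero    f       e = coeffwise λ k → e k z≤n
  tabulate-coeff (suc n) []      e = coeffwise λ
    { zero → refl ; (suc k) → coeff-≈ (tabulate-coeff n [] (λ _ _ → refl)) k }
  tabulate-coeff (suc n) (x ∷ f) e = ∷-cong refl (tabulate-coeff n f (λ k l → e (suc k) (s≤s l)))

  tabulate-cong : ∀ {n} {s t : Vector Carrier n} → (∀ i → s i ≈ t i) → List.tabulate s ≈ₚ List.tabulate t
  tabulate-cong {zero}  e = P.refl
  tabulate-cong {suc n} e = ∷-cong (e zero) (tabulate-cong (e ∘ suc))

  -- List length stands in for the degree: over an arbitrary ring a leading coefficient cannot be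
  -- tested for zero. A list that is too short gets the top coefficient 0.
  split-top : ∀ m f → length f ℕ.≤ suc m →
              ∃₂ λ c f′ → length f′ ℕ.≤ m × f ≈ₚ f′ +ₚ (c ∷ []) *ₚ X ^ m
  split-top zero    []           _       = 0# , [] , z≤n , coeffwise λ
    { zero → sym (trans (+-identityʳ _) (zeroˡ _)) ; (suc k) → refl }
  split-top zero    (x ∷ [])     _       = x , [] , z≤n , P.sym (P.*-identityʳ (x ∷ []))
  split-top zero    (x ∷ y ∷ f)  (s≤s ())
  split-top (suc m) []           _       = 0# , [] , z≤n ,
    P.sym (P.*-congʳ {X ^ suc m} {0# ∷ []} {[]} 0∷[]≈[])
  split-top (suc m) (x ∷ f) (s≤s l) with split-top m f l
  ... | c , f′ , l′ , e = c , x ∷ f′ , s≤s l′ , (begin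
    x ∷ f
      ≈⟨ ∷≈+X* x f ⟩
    (x ∷ []) +ₚ X *ₚ f
      ≈⟨ P.+-congˡ {x ∷ []} (P.*-congˡ {X} e) ⟩
    (x ∷ []) +ₚ X *ₚ (f′ +ₚ (c ∷ []) *ₚ X ^ m)
      ≈⟨ solve 5 (λ x X f c y → x :+ X :* (f :+ c :* y) := (x :+ X :* f) :+ c :* (X :* y))
           P.refl (x ∷ []) X f′ (c ∷ []) (X ^ m) ⟩
    ((x ∷ []) +ₚ X *ₚ f′) +ₚ (c ∷ []) *ₚ (X *ₚ X ^ m)
      ≈⟨ P.+-congʳ {(c ∷ []) *ₚ (X *ₚ X ^ m)} (∷≈+X* x f′) ⟨
    (x ∷ f′) +ₚ (c ∷ []) *ₚ X ^ suc m ∎)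

  length-+∷[] : ∀ {m} f c → length f ℕ.≤ suc m → length (f +ₚ (c ∷ [])) ℕ.≤ suc m
  length-+∷[] []          c l = s≤s z≤n
  length-+∷[] (x ∷ [])    c l = l
  length-+∷[] (x ∷ y ∷ f) c l = l

  -- Passing from f to x + X f multiplies the remainder by X, and its top term c X^(q-1) overflows
  -- to c X^q. Writing X^q = M + X for the divisor M moves c into the quotient and adds c X to the
  -- remainder. As q > 1, that extra term fits without lengthening it.
  divide : ∀ {q} → 1 ℕ.< q → ∀ f → ∃₂ λ h r → length r ℕ.≤ q × f ≈ₚ h *ₚ (X ^ q P.- X) +ₚ r
  divide 1<q                      []      = [] , [] , z≤n , P.refl
  divide 1<q@(s≤s (s≤s {n = m} _)) (x ∷ f) with divide 1<q f
  ... | h , r , l , e with split-top (suc m) r l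
  ... | c , r′ , l′ , e′ =
    X *ₚ h +ₚ (c ∷ []) , x ∷ (r′ +ₚ (c ∷ [])) , s≤s (length-+∷[] r′ c l′) , (begin
    x ∷ f
      ≈⟨ ∷≈+X* x f ⟩
    x′ +ₚ X *ₚ f
      ≈⟨ P.+-congˡ {x′} (P.*-congˡ {X} e) ⟩
    x′ +ₚ X *ₚ (h *ₚ M +ₚ r)
      ≈⟨ P.+-congˡ {x′} (P.*-congˡ {X} (P.+-congˡ {h *ₚ M} e′)) ⟩
    x′ +ₚ X *ₚ (h *ₚ M +ₚ (r′ +ₚ c′ *ₚ X ^ suc m))
      ≈⟨ solve 7 (λ x X h M r c y →
           x :+ X :* (h :* M :+ (r :+ c :* y)) := x :+ X :* (h :* M :+ r) :+ c :* (X :* y))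
           P.refl x′ X h M r′ c′ (X ^ suc m) ⟩
    x′ +ₚ X *ₚ (h *ₚ M +ₚ r′) +ₚ c′ *ₚ X ^ (2 ℕ.+ m)
      ≈⟨ P.+-congˡ {x′ +ₚ X *ₚ (h *ₚ M +ₚ r′)} (P.*-congˡ {c′} M+X) ⟨
    x′ +ₚ X *ₚ (h *ₚ M +ₚ r′) +ₚ c′ *ₚ (M +ₚ X)
      ≈⟨ solve 6 (λ x X h M r c →
           x :+ X :* (h :* M :+ r) :+ c :* (M :+ X) := (X :* h :+ c) :* M :+ (x :+ X :* (r :+ c)))
           P.refl x′ X h M r′ c′ ⟩
    (X *ₚ h +ₚ c′) *ₚ M +ₚ (x′ +ₚ X *ₚ (r′ +ₚ c′))
      ≈⟨ P.+-congˡ {(X *ₚ h +ₚ c′) *ₚ M} (∷≈+X* x (r′ +ₚ c′)) ⟨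
    (X *ₚ h +ₚ c′) *ₚ M +ₚ (x ∷ (r′ +ₚ c′)) ∎)
    where
    x′ = x ∷ []
    c′ = c ∷ []
    M = X ^ (2 ℕ.+ m) P.- X
    M+X : M +ₚ X ≈ₚ X ^ (2 ℕ.+ m)
    M+X = P.trans (P.+-assoc (X ^ (2 ℕ.+ m)) (P.- X) X)
            (P.trans (P.+-congˡ {X ^ (2 ℕ.+ m)} (P.-‿inverseˡ X)) (P.+-identityʳ _))

-- Finite fields

-- Pigeonhole: punching out a missed value would inject `Fin (suc n)` into `Fin n`.
Fin-injective⇒surjective : ∀ {n} (f : Fin n → Fin n) → Injective _≡_ _≡_ f →
                           ∀ j → ∃[ i ] f i ≡ j
Fin-injective⇒surjective {suc n} f inj j with Fin.any? (λ i → f i Fin.≟ j)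
... | yes hit = hit
... | no miss = contradiction
  (Fin.injective⇒≤ {f = λ i → punchOut (λ e → miss (i , ≡.sym e))}
    (λ {i} {k} e → inj (Fin.punchOut-injective
      (λ e → miss (i , ≡.sym e)) (λ e → miss (k , ≡.sym e)) e)))
  ℕ.1+n≰n

module FiniteFieldProperties {q} (F : FiniteField c ℓ q) where
  open FiniteField F hiding (zero)
  open RingOps commutativeRing using (_^_; sum; product)
  open RingProperties ring using (x∙y⁻¹≈ε⇒x≈y; +-cancelˡ)
  open Sum semiring using (sum-cong-≋; *-distribˡ-sum)
  open CommutativeSemiringExp commutativeSemiring using (^-congˡ)
  open SemiringSolver commutativeSemiring
  open SetoidReasoning setoid
  module Product = CommutativeMonoidSum *-commutativeMonoid

  private
    module Enumeration = Inverse cardinality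

  element : Fin q → Carrier
  element = Enumeration.from

  index : Carrier → Fin q
  index = Enumeration.to

  element-index : ∀ x → element (index x) ≈ x
  element-index = Enumeration.strictlyInverseʳ

  index-element : ∀ i → index (element i) ≡ i
  index-element = Enumeration.strictlyInverseˡ

  element-injective : ∀ {i j} → element i ≈ element j → i ≡ j
  element-injective {i} {j} e =
    ≡.trans (≡.sym (index-element i)) (≡.trans (Enumeration.to-cong e) (index-element j))

  infix 4 _≟_
  _≟_ : ∀ x y → Dec (x ≈ y)
  x ≟ y = Dec.map′
    (λ e → trans (sym (element-index x)) (trans (reflexive (≡.cong element e)) (element-index y)))
    Enumeration.to-cong (index x Fin.≟ index y)

  *-cancelˡ-nonZero : ∀ {x y z} → ¬ x ≈ 0# → x * y ≈ x * z → y ≈ z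
  *-cancelˡ-nonZero {x} {y} {z} x≉0 e with inverse x x≉0
  ... | x⁻¹ , xx⁻¹≈1 = begin
    y               ≈⟨ *-identityˡ y ⟨
    1# * y          ≈⟨ *-congʳ xx⁻¹≈1 ⟨
    x * x⁻¹ * y     ≈⟨ solve 3 (λ x i y → x :* i :* y := i :* (x :* y)) refl _ _ _ ⟩
    x⁻¹ * (x * y)   ≈⟨ *-congˡ e ⟩
    x⁻¹ * (x * z)   ≈⟨ solve 3 (λ x i y → i :* (x :* y) := x :* i :* y) refl _ _ _ ⟩
    x * x⁻¹ * z     ≈⟨ *-congʳ xx⁻¹≈1 ⟩
    1# * z          ≈⟨ *-identityˡ z ⟩
    z               ∎

  xy≈0⇒y≈0 : ∀ {x y} → ¬ x ≈ 0# → x * y ≈ 0# → y ≈ 0#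
  xy≈0⇒y≈0 x≉0 e = *-cancelˡ-nonZero x≉0 (trans e (sym (zeroʳ _)))

  xy≈zy⇒y≈0 : ∀ {x y z} → ¬ x ≈ z → x * y ≈ z * y → y ≈ 0#
  xy≈zy⇒y≈0 {x} {y} {z} x≉z e = xy≈0⇒y≈0 (λ d → x≉z (x∙y⁻¹≈ε⇒x≈y x z d)) (begin
    (x - z) * y      ≈⟨ distribʳ y x (- z) ⟩
    x * y + - z * y  ≈⟨ +-congʳ e ⟩
    z * y + - z * y  ≈⟨ distribʳ y z (- z) ⟨
    (z - z) * y      ≈⟨ *-congʳ (-‿inverseʳ z) ⟩
    0# * y           ≈⟨ zeroˡ y ⟩
    0#               ∎)

  product-zero : ∀ {n} (v : Vector Carrier n) → product v ≈ 0# → ∃[ i ] v i ≈ 0#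
  product-zero {zero}  v e = contradiction e 1≉0
  product-zero {suc n} v e with v zero ≟ 0#
  ... | yes v₀≈0 = zero , v₀≈0
  ... | no  v₀≉0 with product-zero (v ∘ suc) (xy≈0⇒y≈0 v₀≉0 e)
  ...   | i , vᵢ≈0 = suc i , vᵢ≈0

  zero-product : ∀ {n} (v : Vector Carrier n) i → v i ≈ 0# → product v ≈ 0#
  zero-product v zero    e = trans (*-congʳ e) (zeroˡ _)
  zero-product v (suc i) e = trans (*-congˡ (zero-product (v ∘ suc) i e)) (zeroʳ _)

  ^-zero : ∀ x k → x ^ k ≈ 0# → x ≈ 0#
  ^-zero x zero    e = contradiction e 1≉0
  ^-zero x (suc k) e with x ≟ 0#
  ... | yes x≈0 = x≈0
  ... | no  x≉0 = ^-zero x k (xy≈0⇒y≈0 x≉0 e)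

  injective⇒surjective : ∀ {f} → Congruent _≈_ _≈_ f → Injective _≈_ _≈_ f →
                         Surjective _≈_ _≈_ f
  injective⇒surjective {f} cong inj y =
    element i , λ {z} e → begin
      f z                          ≈⟨ cong e ⟩
      f (element i)                ≈⟨ element-index _ ⟨
      element (index (f (element i))) ≡⟨ ≡.cong element fi≡y ⟩
      element (index y)            ≈⟨ element-index y ⟩
      y                            ∎
    where
    f′-injective : Injective _≡_ _≡_ (index ∘ f ∘ element)
    f′-injective e = element-injective (inj (trans (sym (element-index _))
      (trans (reflexive (≡.cong element e)) (element-index _))))
    preimage = Fin-injective⇒surjective _ f′-injective (index y)
    i = proj₁ preimage
    fi≡y = proj₂ preimage

  module _ (M : CommutativeMonoid a b) where
    private
      module M = CommutativeMonoid M
    open CommutativeMonoidSum M using (sum-permute) renaming (sum to ∑; sum-cong-≋ to ∑-cong)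

    -- An injective self-map of the field permutes the enumeration. The monoid is left open because
    -- both the product behind Fermat's theorem and the power sums are reindexed.
    ∑-reindex : ∀ {g f} → Congruent _≈_ M._≈_ g → Congruent _≈_ _≈_ f → Injective _≈_ _≈_ f →
                ∑ (g ∘ f ∘ element) M.≈ ∑ (g ∘ element)
    ∑-reindex {g} {f} g-cong f-cong inj = M.sym (M.trans
      (sum-permute (g ∘ element) π)
      (∑-cong (λ i → g-cong (element-index (f (element i))))))
      where
      surj = injective⇒surjective f-cong inj
      f⁻¹ : Carrier → Carrier
      f⁻¹ y = proj₁ (surj y)
      ff⁻¹ : ∀ y → f (f⁻¹ y) ≈ y
      ff⁻¹ y = proj₂ (surj y) refl
      π : Permutation.Permutation q q
      π = Permutation.permutation (index ∘ f ∘ element) (index ∘ f⁻¹ ∘ element)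
        (λ j → ≡.trans (Enumeration.to-cong (trans (f-cong (element-index _)) (ff⁻¹ _)))
                       (index-element j))
        (λ i → ≡.trans (Enumeration.to-cong
          (inj (trans (ff⁻¹ _) (element-index _)))) (index-element i))

  -- The source of the exponent q - 1 in Fermat's theorem: `i` will be the index of 0.
  product-all-but-one : ∀ {n} (v : Vector Carrier n) i {x} → v i ≈ 1# →
                        (∀ j → j ≢ i → v j ≈ x) → product v ≈ x ^ (n ℕ.∸ 1)
  product-all-but-one {suc n} v i {x} vᵢ≈1 vⱼ≈x = begin
    product v                        ≈⟨ Product.sum-remove {i = i} v ⟩
    v i * product (Vec.removeAt v i) ≈⟨ *-cong vᵢ≈1 (Product.sum-cong-≋ λ j →
                                          vⱼ≈x (punchIn i j) (Fin.punchInᵢ≢i i j)) ⟩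
    1# * product (Vec.replicate n x) ≈⟨ *-identityˡ _ ⟩
    product (Vec.replicate n x)      ≈⟨ Product.sum-replicate n ⟩
    x ^ n                            ∎

  private
    -- Putting the neutral value 1 at 0 turns a product over the nonzero elements into one over the
    -- whole enumeration.
    onNonZero : (Carrier → Carrier) → Carrier → Carrier
    onNonZero g x with x ≟ 0#
    ... | yes _ = 1#
    ... | no  _ = g x

    onNonZero-0 : ∀ g {x} → x ≈ 0# → onNonZero g x ≈ 1#
    onNonZero-0 g {x} x≈0 with x ≟ 0#
    ... | yes _   = refl
    ... | no  x≉0 = contradiction x≈0 x≉0

    onNonZero-≉0 : ∀ g {x} → ¬ x ≈ 0# → onNonZero g x ≈ g x
    onNonZero-≉0 g {x} x≉0 with x ≟ 0#
    ... | yes x≈0 = contradiction x≈0 x≉0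
    ... | no  _   = refl

  -- Multiplication by x permutes the nonzero elements, so it preserves their
  -- product.
  fermat : ∀ {x} → ¬ x ≈ 0# → x ^ (q ℕ.∸ 1) ≈ 1#
  fermat {x} x≉0 = begin
    x ^ (q ℕ.∸ 1)
      ≈⟨ product-all-but-one (factor ∘ element) (index 0#)
           (onNonZero-0 _ (element-index 0#))
           (λ j j≢ → onNonZero-≉0 _ (λ e → j≢ (element-injective (trans e (sym (element-index 0#)))))) ⟨
    product (factor ∘ element)
      ≈⟨ *-cancelˡ-nonZero Π≉0 (begin
           Π * product (factor ∘ element)
             ≈⟨ Product.∑-distrib-+ (value ∘ element) (factor ∘ element) ⟨
           product (λ i → value (element i) * factor (element i))
             ≈⟨ Product.sum-cong-≋ (λ i → scale (element i)) ⟨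
           product (λ i → value (x * element i))
             ≈⟨ ∑-reindex *-commutativeMonoid value-cong *-congˡ (*-cancelˡ-nonZero x≉0) ⟩
           Π
             ≈⟨ *-identityʳ Π ⟨
           Π * 1# ∎) ⟩
    1# ∎
    where
    factor value : Carrier → Carrier
    factor = onNonZero (λ _ → x)
    value  = onNonZero id
    Π = product (value ∘ element)

    value≉0 : ∀ y → ¬ value y ≈ 0#
    value≉0 y e with y ≟ 0#
    ... | yes _   = 1≉0 e
    ... | no  y≉0 = y≉0 e

    Π≉0 : ¬ Π ≈ 0#
    Π≉0 e = value≉0 _ (proj₂ (product-zero (value ∘ element) e))

    value-cong : Congruent _≈_ _≈_ value
    value-cong {y} {z} y≈z with y ≟ 0#
    ... | yes y≈0 = sym (onNonZero-0 id (trans (sym y≈z) y≈0))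
    ... | no  y≉0 = trans y≈z (sym (onNonZero-≉0 id (y≉0 ∘ trans y≈z)))

    scale : ∀ y → value (x * y) ≈ value y * factor y
    scale y with y ≟ 0#
    ... | yes y≈0 = trans (onNonZero-0 id (trans (*-congˡ y≈0) (zeroʳ x))) (sym (*-identityˡ 1#))
    ... | no  y≉0 = trans (onNonZero-≉0 id (y≉0 ∘ xy≈0⇒y≈0 x≉0)) (*-comm x y)

  -- Counting the roots of a univariate polynomial

  open Univariate commutativeRing using (_≈ₚ_; coeffwise; coeff-≈)

  horner : List Carrier → Carrier → Carrier
  horner f x = List.foldr (λ a acc → a + x * acc) 0# f

  horner-zero : ∀ f x → f ≈ₚ [] → horner f x ≈ 0#
  horner-zero []      x e = refl
  horner-zero (a ∷ f) x e = begin
    a + x * horner f x  ≈⟨ +-cong (coeff-≈ e 0)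
                            (*-congˡ (horner-zero f x (coeffwise (coeff-≈ e ∘ suc)))) ⟩
    0# + x * 0#         ≈⟨ +-identityˡ _ ⟩
    x * 0#              ≈⟨ zeroʳ x ⟩
    0#                  ∎

  -- The quotient of x f(x) − p f(p) by x − p.
  quotientAt : Carrier → List Carrier → List Carrier
  quotientAt p []      = []
  quotientAt p (a ∷ f) = horner (a ∷ f) p ∷ quotientAt p f

  length-quotientAt : ∀ p f → length (quotientAt p f) ≡ length f
  length-quotientAt p []      = ≡.refl
  length-quotientAt p (a ∷ f) = ≡.cong suc (length-quotientAt p f)

  -- This is (x - p) Q(x) = x f(x) - p f(p) with the negative terms moved across, so that the
  -- semiring solver applies.
  horner-quotientAt : ∀ p f x → x * horner f x + p * horner (quotientAt p f) x ≈
                                p * horner f p + x * horner (quotientAt p f) x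
  horner-quotientAt p []      x =
    +-cong (trans (zeroʳ x) (sym (zeroʳ p))) (trans (zeroʳ p) (sym (zeroʳ x)))
  horner-quotientAt p (a ∷ f) x = begin
    x * (a + x * H) + p * ((a + p * Hₚ) + x * Q)
      ≈⟨ solve 6 (λ x a H p G Q →
           x :* (a :+ x :* H) :+ p :* ((a :+ p :* G) :+ x :* Q) :=
           (x :* a :+ p :* (a :+ p :* G)) :+ x :* (x :* H :+ p :* Q)) refl x a H p Hₚ Q ⟩
    (x * a + p * (a + p * Hₚ)) + x * (x * H + p * Q)
      ≈⟨ +-congˡ (*-congˡ (horner-quotientAt p f x)) ⟩
    (x * a + p * (a + p * Hₚ)) + x * (p * Hₚ + x * Q)
      ≈⟨ solve 5 (λ x a p G Q →
           (x :* a :+ p :* (a :+ p :* G)) :+ x :* (p :* G :+ x :* Q) :=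
           p :* (a :+ p :* G) :+ x :* ((a :+ p :* G) :+ x :* Q)) refl x a p Hₚ Q ⟩
    p * (a + p * Hₚ) + x * ((a + p * Hₚ) + x * Q) ∎
    where
    H = horner f x
    Hₚ = horner f p
    Q = horner (quotientAt p f) x

  quotientAt-zero : ∀ p f → quotientAt p f ≈ₚ [] → f ≈ₚ []
  quotientAt-zero p []      e = e
  quotientAt-zero p (a ∷ f) e = coeffwise λ
    { zero    → begin
        a                  ≈⟨ +-identityʳ a ⟨
        a + 0#             ≈⟨ +-congˡ (trans (*-congˡ (horner-zero f p f≈0)) (zeroʳ p)) ⟨
        a + p * horner f p ≈⟨ coeff-≈ e 0 ⟩
        0#                 ∎
    ; (suc k) → coeff-≈ f≈0 k
    }
    where
    f≈0 : f ≈ₚ []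
    f≈0 = quotientAt-zero p f (coeffwise (coeff-≈ e ∘ suc))

  -- Factor theorem: if p₀ is a root of a + x f(x), subtracting its value 0 at p₀ cancels a and
  -- leaves x f(x) - p₀ f(p₀) = (x - p₀) Q(x). So Q, with one coefficient fewer, vanishes at the
  -- other points.
  roots≥length⇒zero : ∀ n f → length f ℕ.≤ n → (p : Vector Carrier n) → Injective _≡_ _≈_ p →
                      (∀ i → horner f (p i) ≈ 0#) → f ≈ₚ []
  roots≥length⇒zero n       []      _       p inj root = coeffwise λ _ → refl
  roots≥length⇒zero (suc n) (a ∷ f) (s≤s l) p inj root = coeffwise λ
    { zero    → begin
        a                    ≈⟨ +-identityʳ a ⟨
        a + 0#               ≈⟨ +-congˡ (trans (*-congˡ (horner-zero f p₀ f≈0)) (zeroʳ p₀)) ⟨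
        a + p₀ * horner f p₀ ≈⟨ root zero ⟩
        0#                   ∎
    ; (suc k) → coeff-≈ f≈0 k
    }
    where
    p₀ = p zero

    quotient-root : ∀ i → horner (quotientAt p₀ f) (p (suc i)) ≈ 0#
    quotient-root i = xy≈zy⇒y≈0
      (λ e → contradiction (inj e) λ ())
      (+-cancelˡ (p₀ * horner f p₀) _ _ (begin
        p₀ * horner f p₀ + p₀ * Q  ≈⟨ +-congʳ (+-cancelˡ a _ _
                                          (trans (root zero) (sym (root (suc i))))) ⟩
        x * horner f x + p₀ * Q    ≈⟨ horner-quotientAt p₀ f x ⟩
        p₀ * horner f p₀ + x * Q   ∎))
      where
      x = p (suc i)
      Q = horner (quotientAt p₀ f) x

    f≈0 : f ≈ₚ []
    f≈0 = quotientAt-zero p₀ f (roots≥length⇒zero n (quotientAt p₀ f)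
      (ℕ.≤-trans (ℕ.≤-reflexive (length-quotientAt p₀ f)) l)
      (p ∘ suc) (λ e → Fin.suc-injective (inj e)) quotient-root)

  vanishing⇒zero : ∀ f → length f ℕ.≤ q → (∀ x → horner f x ≈ 0#) → f ≈ₚ []
  vanishing⇒zero f l root =
    roots≥length⇒zero q f l element element-injective (root ∘ element)

  infixl 8 _⟨_⟩ᵥ
  _⟨_⟩ᵥ : ∀ {n} → Vector Carrier n → Carrier → Carrier
  s ⟨ x ⟩ᵥ = sum λ i → s i * x ^ toℕ i

  horner-tabulate : ∀ {n} (s : Vector Carrier n) x → horner (List.tabulate s) x ≈ s ⟨ x ⟩ᵥ
  horner-tabulate {zero}  s x = refl
  horner-tabulate {suc n} s x = begin
    s zero + x * horner (List.tabulate (s ∘ suc)) x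
      ≈⟨ +-cong (sym (*-identityʳ _)) (*-congˡ (horner-tabulate (s ∘ suc) x)) ⟩
    s zero * 1# + x * ((s ∘ suc) ⟨ x ⟩ᵥ)
      ≈⟨ +-congˡ (*-distribˡ-sum x (λ i → s (suc i) * x ^ toℕ i)) ⟩
    s zero * 1# + sum (λ i → x * (s (suc i) * x ^ toℕ i))
      ≈⟨ +-congˡ (sum-cong-≋ λ i → solve 3 (λ x s y → x :* (s :* y) := s :* (x :* y))
           refl x (s (suc i)) (x ^ toℕ i)) ⟩
    s ⟨ x ⟩ᵥ ∎

  ⟨⟩ᵥ-vanishing : (s : Vector Carrier q) → (∀ x → s ⟨ x ⟩ᵥ ≈ 0#) → ∀ i → s i ≈ 0#
  ⟨⟩ᵥ-vanishing s e i = trans (sym (coeff-tabulate s i)) (coeff-≈ (vanishing⇒zero (List.tabulate s)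
    (ℕ.≤-reflexive (List.length-tabulate s)) (λ x → trans (horner-tabulate s x) (e x))) (toℕ i))
    where open UnivariateProperties commutativeRing

  ⟨⟩ᵥ-cong : ∀ {n} (s : Vector Carrier n) {x y} → x ≈ y → s ⟨ x ⟩ᵥ ≈ s ⟨ y ⟩ᵥ
  ⟨⟩ᵥ-cong {n} s e = sum-cong-≋ {n} λ i → *-congˡ (^-congˡ (toℕ i) e)

-- Power sums over the field

module FiniteFieldProperties₃ {m} (F : FiniteField c ℓ (3 ℕ.+ m)) where
  open FiniteField F hiding (zero)
  open FiniteFieldProperties F
  open RingOps commutativeRing using (_^_; sum)
  open RingProperties ring using (-0#≈0#; +-cancelʳ; +-identityʳ-unique; -‿injective)
  open Sum semiring using
    (sum-cong-≋; sum-init-last; sum-remove; *-distribˡ-sum; ∑-comm; ∑-distrib-+; sum-replicate-zero)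
  open CommutativeSemiringExp commutativeSemiring using (^-distrib-*; ^-congˡ)
  open SemiringSolver commutativeSemiring
  open SetoidReasoning setoid
  open Univariate commutativeRing using (coeff-≈)

  q : ℕ
  q = 3 ℕ.+ m

  0^q-1 : ∀ {x} → x ≈ 0# → x ^ (q ℕ.∸ 1) ≈ 0#
  0^q-1 x≈0 = trans (*-congʳ x≈0) (zeroˡ _)

  x^q≈x : ∀ x → x ^ q ≈ x
  x^q≈x x with x ≟ 0#
  ... | yes x≈0 = trans (*-congʳ x≈0) (trans (zeroˡ _) (sym x≈0))
  ... | no  x≉0 = trans (*-congˡ (fermat x≉0)) (*-identityʳ x)

  powerSum : ℕ → Carrier
  powerSum k = sum λ i → element i ^ k

  -- This sum is q times 1. Since x ↦ x + 1 permutes the field, Σ x = Σ (x + 1) = Σ x + q times 1.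
  powerSum-0 : powerSum 0 ≈ 0#
  powerSum-0 = +-identityʳ-unique (sum element) (powerSum 0) (begin
    sum element + powerSum 0      ≈⟨ ∑-distrib-+ element (λ _ → 1#) ⟨
    sum (λ i → element i + 1#)    ≈⟨ ∑-reindex +-commutativeMonoid id +-congʳ (+-cancelʳ 1# _ _) ⟩
    sum element                   ∎)

  -- By Fermat the sum is q - 1 times 1. One further 1 makes it `powerSum 0`, which is 0; so its
  -- value is -1.
  powerSum-q-1≉0 : ¬ powerSum (q ℕ.∸ 1) ≈ 0#
  powerSum-q-1≉0 e = 1≉0 (begin
    1#                               ≈⟨ +-identityʳ 1# ⟨
    1# + 0#                          ≈⟨ +-congˡ e ⟨
    1# + powerSum (q ℕ.∸ 1)          ≈⟨ +-congˡ (sum-remove {i = i₀} λ i → element i ^ (q ℕ.∸ 1)) ⟩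
    1# + (element i₀ ^ (q ℕ.∸ 1) + sum (λ j → element (punchIn i₀ j) ^ (q ℕ.∸ 1)))
                                     ≈⟨ +-congˡ (+-cong (0^q-1 (element-index 0#))
                                                         (sum-cong-≋ λ j → fermat (nonZero j))) ⟩
    1# + (0# + sum {2 ℕ.+ m} (λ j → 1#)) ≈⟨ +-congˡ (+-identityˡ _) ⟩
    powerSum 0                       ≈⟨ powerSum-0 ⟩
    0#                               ∎)
    where
    i₀ = index 0#
    nonZero : ∀ j → ¬ element (punchIn i₀ j) ≈ 0#
    nonZero j e = Fin.punchInᵢ≢i i₀ j (element-injective (trans e (sym (element-index 0#))))

  -- Scaling the summation variable by g multiplies the sum by gᵏ.
  powerSum-scale : ∀ k {g} → ¬ g ^ suc k ≈ g → powerSum k ≈ 0#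
  powerSum-scale k {g} gᵏ⁺¹≉g = xy≈zy⇒y≈0 {g ^ k} {z = 1#}
    (λ e → gᵏ⁺¹≉g (trans (*-congˡ e) (*-identityʳ g)))
    (begin
      g ^ k * powerSum k                   ≈⟨ *-distribˡ-sum (g ^ k) (λ i → element i ^ k) ⟩
      sum (λ i → g ^ k * element i ^ k)    ≈⟨ sum-cong-≋ (λ i → ^-distrib-* g (element i) k) ⟨
      sum (λ i → (g * element i) ^ k)      ≈⟨ ∑-reindex +-commutativeMonoid (^-congˡ k) *-congˡ
                                                (*-cancelˡ-nonZero g≉0) ⟩
      powerSum k                           ≈⟨ *-identityˡ _ ⟨
      1# * powerSum k                      ∎)
    where
    g≉0 : ¬ g ≈ 0#
    g≉0 e = gᵏ⁺¹≉g (trans (*-congʳ e) (trans (zeroˡ _) (sym e)))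

  private
    monomial : ℕ → List Carrier
    monomial zero    = 1# ∷ []
    monomial (suc k) = 0# ∷ monomial k

    horner-monomial : ∀ k x → horner (monomial k) x ≈ x ^ k
    horner-monomial zero    x = trans (+-congˡ (zeroʳ x)) (+-identityʳ 1#)
    horner-monomial (suc k) x = trans (+-identityˡ _) (*-congˡ (horner-monomial k x))

    length-monomial : ∀ k → length (monomial k) ≡ suc k
    length-monomial zero    = ≡.refl
    length-monomial (suc k) = ≡.cong suc (length-monomial k)

  -- Otherwise X^(k+2) − X would have more roots than its degree.
  ∃-power≉ : ∀ k → suc k ℕ.< q ℕ.∸ 1 → ∃[ g ] ¬ g ^ (2 ℕ.+ k) ≈ g
  ∃-power≉ k k<q-2 with Fin.any? (λ i → Dec.¬? (element i ^ (2 ℕ.+ k) ≟ element i))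
  ... | yes (i , g≉) = element i , g≉
  ... | no none = contradiction 1≈0 1≉0
    where
    f = 0# ∷ - 1# ∷ monomial k

    all : ∀ x → x ^ (2 ℕ.+ k) ≈ x
    all x = Dec.decidable-stable (_ ≟ _) λ x≉ → none (index x , λ e → x≉
      (trans (^-congˡ (2 ℕ.+ k) (sym (element-index x))) (trans e (element-index x))))

    root : ∀ x → horner f x ≈ 0#
    root x = begin
      0# + x * (- 1# + x * horner (monomial k) x) ≈⟨ +-identityˡ _ ⟩
      x * (- 1# + x * horner (monomial k) x)      ≈⟨ *-congˡ (+-congˡ (*-congˡ (horner-monomial k x))) ⟩
      x * (- 1# + x * x ^ k)                      ≈⟨ distribˡ x _ _ ⟩
      x * - 1# + x ^ (2 ℕ.+ k)                    ≈⟨ +-congˡ (trans (all x) (sym (*-identityʳ x))) ⟩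
      x * - 1# + x * 1#                           ≈⟨ distribˡ x _ _ ⟨
      x * (- 1# + 1#)                             ≈⟨ *-congˡ (-‿inverseˡ 1#) ⟩
      x * 0#                                      ≈⟨ zeroʳ x ⟩
      0#                                          ∎

    1≈0 : 1# ≈ 0#
    1≈0 = -‿injective (trans (coeff-≈ (vanishing⇒zero f
      (ℕ.≤-trans (ℕ.≤-reflexive (≡.cong (2 ℕ.+_) (length-monomial k))) (s≤s k<q-2)) root) 1)
      (sym -0#≈0#))

  -- The exponent 0 stands apart because g⁰ = 1 for every g, so that scaling gives nothing.
  powerSum-<q-1 : ∀ k → k ℕ.< q ℕ.∸ 1 → powerSum k ≈ 0#
  powerSum-<q-1 zero    _     = powerSum-0
  powerSum-<q-1 (suc k) k<q-1 = powerSum-scale (suc k) (proj₂ (∃-power≉ k k<q-1))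

  -- Summing over the field, Σ f(x) = - s (q-1) for every f of degree below q,
  -- while a permutation has Σ f(x) = Σ x = 0.
  permutation⇒top≈0 : (s : Vector Carrier q) → Injective _≈_ _≈_ (s ⟨_⟩ᵥ) →
                      s (Fin.fromℕ (q ℕ.∸ 1)) ≈ 0#
  permutation⇒top≈0 s inj = xy≈0⇒y≈0 powerSum-q-1≉0 (begin
    powerSum (q ℕ.∸ 1) * s (Fin.fromℕ (q ℕ.∸ 1))
      ≈⟨ *-comm _ _ ⟩
    s (Fin.fromℕ (q ℕ.∸ 1)) * powerSum (q ℕ.∸ 1)
      ≡⟨ ≡.cong (λ k → s (Fin.fromℕ (q ℕ.∸ 1)) * powerSum k) (Fin.toℕ-fromℕ (q ℕ.∸ 1)) ⟨
    t (Fin.fromℕ (q ℕ.∸ 1))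
      ≈⟨ +-identityˡ _ ⟨
    0# + t (Fin.fromℕ (q ℕ.∸ 1))
      ≈⟨ +-congʳ (trans (sum-cong-≋ lower≈0) (sum-replicate-zero (q ℕ.∸ 1))) ⟨
    sum (Vec.init t) + Vec.last t
      ≈⟨ sum-init-last t ⟨
    sum t
      ≈⟨ sum-cong-≋ (λ i → *-distribˡ-sum (s i) (λ j → element j ^ toℕ i)) ⟩
    sum (λ i → sum λ j → s i * element j ^ toℕ i)
      ≈⟨ ∑-comm (λ i j → s i * element j ^ toℕ i) ⟩
    sum (λ j → s ⟨ element j ⟩ᵥ)
      ≈⟨ ∑-reindex +-commutativeMonoid id (⟨⟩ᵥ-cong s) inj ⟩
    sum element
      ≈⟨ sum-cong-≋ (λ i → *-identityʳ (element i)) ⟨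
    powerSum 1
      ≈⟨ powerSum-<q-1 1 (s≤s (s≤s z≤n)) ⟩
    0# ∎)
    where
    t : Vector Carrier q
    t i = s i * powerSum (toℕ i)

    lower≈0 : ∀ i → Vec.init t i ≈ 0#
    lower≈0 i = trans (*-congˡ (powerSum-<q-1 _
      (≡.subst (ℕ._< q ℕ.∸ 1) (≡.sym (Fin.toℕ-inject₁ i)) (Fin.toℕ<n i)))) (zeroʳ _)

module _ {q} (F : FiniteField c ℓ q) where
  open FiniteField F
  open FiniteFieldProperties F using (_⟨_⟩ᵥ)
  open RingOps commutativeRing using (_^_)

  -- Here and in the next two lemmas, matching on the inequality turns q into 3 + m, so that `q ∸ 1`
  -- reduces to a successor and powers unfold.
  0^q-1 : 2 ℕ.< q → ∀ {x} → x ≈ 0# → x ^ (q ℕ.∸ 1) ≈ 0#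
  0^q-1 (s≤s (s≤s (s≤s _))) = FiniteFieldProperties₃.0^q-1 F

  x^q≈x : 2 ℕ.< q → ∀ x → x ^ q ≈ x
  x^q≈x (s≤s (s≤s (s≤s _))) = FiniteFieldProperties₃.x^q≈x F

  permutation⇒top≈0 : 2 ℕ.< q → (s : Vector Carrier q) → Injective _≈_ _≈_ (s ⟨_⟩ᵥ) →
                      ∀ i → toℕ i ≡ q ℕ.∸ 1 → s i ≈ 0#
  permutation⇒top≈0 (s≤s (s≤s (s≤s _))) s inj i i≡q-1 =
    ≡.subst (λ i → s i ≈ 0#) (Fin.toℕ-injective (≡.trans (Fin.toℕ-fromℕ _) (≡.sym i≡q-1)))
      (FiniteFieldProperties₃.permutation⇒top≈0 F s inj)

-- Cardinalities of decidable subsets and of vectors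

-- `subsetoid` compares first components only, so an index counts once however many proofs of `P` it
-- has.
Fin-subset-cardinality : ∀ {N} {P : Pred (Fin N) p} → Decidable P →
                         ∃ (HasCardinality (subsetoid (≡.setoid (Fin N)) P))
Fin-subset-cardinality {N = zero} P? = 0 , record
  { to        = λ ()
  ; from      = λ ()
  ; to-cong   = λ { {()} }
  ; from-cong = λ { {()} }
  ; inverse   = (λ { {()} }) , λ { {()} }
  }
Fin-subset-cardinality {N = suc N} {P} P? with P? zero | Fin-subset-cardinality (P? ∘ suc)
... | no ¬P₀ | k , tail = k , record
  { to        = λ { (zero , P₀) → contradiction P₀ ¬P₀ ; (suc i , Pᵢ) → T.to (i , Pᵢ) }
  ; from      = λ j → suc (proj₁ (T.from j)) , proj₂ (T.from j)
  ; to-cong   = λ { {zero , P₀} → contradiction P₀ ¬P₀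
                  ; {suc i , _} {suc i , _} ≡.refl → T.to-cong ≡.refl }
  ; from-cong = λ e → ≡.cong suc (T.from-cong e)
  ; inverse   = (λ { {_} {zero , P₀} → contradiction P₀ ¬P₀
                   ; {_} {suc i , _} e → T.inverseˡ (Fin.suc-injective e) })
              , (λ { {zero , P₀} → contradiction P₀ ¬P₀
                   ; {suc i , _} e → ≡.cong suc (T.inverseʳ e) })
  }
  where module T = Inverse tail
... | yes P₀ | k , tail = suc k , record
  { to        = λ { (zero , _) → zero ; (suc i , Pᵢ) → suc (T.to (i , Pᵢ)) }
  ; from      = λ { zero → zero , P₀ ; (suc j) → suc (proj₁ (T.from j)) , proj₂ (T.from j) }
  ; to-cong   = λ { {zero , _} {zero , _} _ → ≡.refl
                  ; {suc i , _} {suc i , _} ≡.refl → ≡.cong suc (T.to-cong ≡.refl) }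
  ; from-cong = λ { ≡.refl → ≡.refl }
  ; inverse   = (λ { {zero} {zero , _} _ → ≡.refl
                   ; {suc j} {suc i , _} e → ≡.cong suc (T.inverseˡ (Fin.suc-injective e)) })
              , (λ { {zero , _} ≡.refl → ≡.refl
                   ; {suc i , _} ≡.refl → ≡.cong suc (T.inverseʳ ≡.refl) })
  }
  where module T = Inverse tail

subset-cardinality : ∀ {N} {S : Setoid a b} {P : Pred (Setoid.Carrier S) p} →
                     HasCardinality S N →
                     (∀ {x y} → Setoid._≈_ S x y → P x → P y) → Decidable P →
                     ∃ (HasCardinality (subsetoid S P))
subset-cardinality {S = S} {P} |S|≡N P-resp P?
  with Fin-subset-cardinality (λ i → P? (Inverse.from |S|≡N i))
... | k , sub = k , record
  { to        = λ (x , Px) → T.to (E.to x , P-resp (S.sym (E.strictlyInverseʳ x)) Px)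
  ; from      = λ i → E.from (proj₁ (T.from i)) , proj₂ (T.from i)
  ; to-cong   = λ x≈y → T.to-cong (E.to-cong x≈y)
  ; from-cong = λ e → E.from-cong (T.from-cong e)
  ; inverse   = (λ e → T.inverseˡ (E.inverseˡ e))
              , (λ e → E.inverseʳ (T.inverseʳ e))
  }
  where
  module S = Setoid S
  module E = Inverse |S|≡N
  module T = Inverse sub

funToFin-cong : ∀ {m n} {f g : Fin m → Fin n} → (∀ i → f i ≡ g i) → funToFin f ≡ funToFin g
funToFin-cong {zero}  e = ≡.refl
funToFin-cong {suc m} e = ≡.cong₂ combine (e zero) (funToFin-cong (e ∘ suc))

vector-cardinality : ∀ {N} {S : Setoid a b} → HasCardinality S N → ∀ n →
                     HasCardinality (Pointwise.setoid S n) (N ℕ.^ n)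
vector-cardinality {N = N} {S} |S|≡N n = record
  { to        = λ s → funToFin (E.to ∘ s)
  ; from      = λ k i → E.from (finToFun {N} {n} k i)
  ; to-cong   = λ e → funToFin-cong (E.to-cong ∘ e)
  ; from-cong = λ { ≡.refl i → S.refl }
  ; inverse   = (λ {k} e → ≡.trans (funToFin-cong (E.inverseˡ ∘ e)) (Fin.funToFin-finToFin {n} {N} k))
              , (λ { {s} ≡.refl i → E.inverseʳ (Fin.finToFun-funToFin (E.to ∘ s) i) })
  }
  where
  module S = Setoid S
  module E = Inverse |S|≡N

-- The Nullstellensatz over a finite field

module Dichotomies (R : CommutativeRing c ℓ) (n : ℕ) where
  open CommutativeRing R using (Carrier; _≈_; 0#; trans; sym; +-cong; +-identityˡ; *-congˡ; zeroʳ)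
  open Multivariate R using (eval)
  open Ideals (MPoly R n)
  open MultivariateEvaluation R using (eval-hom)
  private
    module P = CommutativeRing (MPoly R n)

  VanishesAt : Ideal (MPoly R n) p → Vector Carrier n → Set _
  VanishesAt I s = ∀ f → f ∈ I → eval n f s ≈ 0#

  -- Stronger than deciding `VanishesAt`: the negative answer carries a member that can be divided
  -- by at `s`. In this form it also passes to sums of ideals.
  Dichotomy : Ideal (MPoly R n) p → Set _
  Dichotomy I = ∀ s → VanishesAt I s ⊎ ∃[ g ] (g ∈ I × ¬ eval n g s ≈ 0#)

  module _ {G : Set ι} (g : G → P.Carrier) (s : Vector Carrier n) where
    open Homomorphism (MPoly R n) R (eval-hom n s)

    -- The kernel of evaluation at `s` is an ideal, so the induction runs over the derivation of
    -- membership.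
    generators-vanish : (∀ i → eval n (g i) s ≈ 0#) → VanishesAt ⟨ g ⟩ s
    generators-vanish v _ (gen i)    = v i
    generators-vanish v _ (resp e h) = trans (⟦⟧-cong (P.sym e)) (generators-vanish v _ h)
    generators-vanish v _ nil        = 0#-homo
    generators-vanish v _ (add h k)  = trans (+-homo _ _)
      (trans (+-cong (generators-vanish v _ h) (generators-vanish v _ k)) (+-identityˡ 0#))
    generators-vanish v _ (mul r h)  = trans (*-homo _ _)
      (trans (*-congˡ (generators-vanish v _ h)) (zeroʳ _))

  module _ (I : Ideal (MPoly R n) p) (J : Ideal (MPoly R n) ℓ₁) where
    ∈-⊕ˡ : ∀ {f} → f ∈ I → f ∈ I ⊕ J
    ∈-⊕ˡ f∈I = _ , _ , f∈I , Ideal.0∈ J , P.sym (P.+-identityʳ _)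

    ∈-⊕ʳ : ∀ {f} → f ∈ J → f ∈ I ⊕ J
    ∈-⊕ʳ f∈J = _ , _ , Ideal.0∈ I , f∈J , P.sym (P.+-identityˡ _)

    VanishesAt-⊕ : ∀ {s} → VanishesAt I s → VanishesAt J s → VanishesAt (I ⊕ J) s
    VanishesAt-⊕ {s} v w f (y , z , y∈I , z∈J , e) = trans (⟦⟧-cong e) (trans (+-homo y z)
      (trans (+-cong (v y y∈I) (w z z∈J)) (+-identityˡ 0#)))
      where open Homomorphism (MPoly R n) R (eval-hom n s)

    Dichotomy-⊕ : Dichotomy I → Dichotomy J → Dichotomy (I ⊕ J)
    Dichotomy-⊕ dI dJ s with dI s | dJ s
    ... | inj₁ v | inj₁ w = inj₁ (VanishesAt-⊕ v w)
    ... | inj₁ _ | inj₂ (g , g∈J , g≉0) = inj₂ (g , ∈-⊕ʳ g∈J , g≉0)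
    ... | inj₂ (g , g∈I , g≉0) | _      = inj₂ (g , ∈-⊕ˡ g∈I , g≉0)

-- Polynomials vanishing everywhere, and indicators of points

module FieldEquations {q} (F : FiniteField c ℓ q) (2<q : 2 ℕ.< q) where
  open FiniteField F hiding (zero)
  open FiniteFieldProperties F
  open RingOps commutativeRing using (_^_; sum; product)
  open RingProperties ring using (x∙y⁻¹≈ε⇒x≈y; -0#≈0#; x≈y⇒x∙y⁻¹≈ε)
  open Sum semiring using (sum-cong-≋; sum-remove; sum-replicate-zero)
  open CommutativeSemiringExp commutativeSemiring using (^-congˡ)
  open Multivariate commutativeRing
  open MultivariateEvaluation commutativeRing
  open OverFiniteField F using (module Ops)

  fieldEquation : ∀ n → Fin n → Poly n
  fieldEquation n i = var n i ⊛^ q ⊝ var n i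
    where open Ops n

  module _ (n : ℕ) where
    open Ideals (MPoly commutativeRing n) using (Generated; gen; resp; nil; add; mul)
    open Ideals (MPoly commutativeRing (suc n)) using () renaming
      (Generated to Generated⁺; gen to gen⁺; resp to resp⁺; nil to nil⁺; add to add⁺; mul to mul⁺)
    private
      module P = CommutativeRing (MPoly commutativeRing n)
      module P⁺ = CommutativeRing (MPoly commutativeRing (suc n))
    open UnivariateProperties (MPoly commutativeRing n)
    open Univariate (MPoly commutativeRing n)

    -- Embedding as constants in x₀ is a ring homomorphism that sends the field equation of variable
    -- `i` to that of `suc i`, so derivations of membership are carried along.
    constant-∈ : ∀ {f} → Generated (fieldEquation n) f →
                 Generated⁺ (fieldEquation (suc n)) (f ∷ [])
    constant-∈ (gen i)       = resp⁺ (P⁺.sym (P⁺.trans (∸-homo (var n i ⊛^ q) (var n i))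
      (P⁺.+-congʳ { P⁺.- var (suc n) (suc i)} (^-homo (var n i) q)))) (gen⁺ (suc i))
      where
      open Homomorphism (MPoly commutativeRing n) (MPoly commutativeRing (suc n)) constant-hom
      open Ops n
    constant-∈ (resp e h)    = resp⁺ (∷-cong e P⁺.refl) (constant-∈ h)
    constant-∈ nil           = resp⁺ (≈ₚ-sym 0∷[]≈[]) nil⁺
    constant-∈ (add h k)     = add⁺ (constant-∈ h) (constant-∈ k)
    constant-∈ (mul r {f} h) = resp⁺ (P⁺.sym (*-homo r f)) (mul⁺ (r ∷ []) (constant-∈ h))
      where open Homomorphism (MPoly commutativeRing n) (MPoly commutativeRing (suc n)) constant-hom

    coefficients-∈ : ∀ f → (∀ k → Generated (fieldEquation n) (coeff f k)) →
                     Generated⁺ (fieldEquation (suc n)) f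
    coefficients-∈ []      h = nil⁺
    coefficients-∈ (a ∷ f) h = resp⁺ (P⁺.sym (∷≈+X* a f))
      (add⁺ (constant-∈ (h 0)) (mul⁺ X (coefficients-∈ f (h ∘ suc))))

  fieldEquation-vanishes : ∀ n i s → eval n (fieldEquation n i) s ≈ 0#
  fieldEquation-vanishes n i s = begin
    eval n (fieldEquation n i) s                 ≈⟨ ∸-homo (var n i ⊛^ q) (var n i) ⟩
    eval n (var n i ⊛^ q) s - eval n (var n i) s ≈⟨ +-congʳ (^-homo (var n i) q) ⟩
    eval n (var n i) s ^ q - eval n (var n i) s  ≈⟨ +-congʳ (x^q≈x F 2<q _) ⟩
    eval n (var n i) s - eval n (var n i) s      ≈⟨ -‿inverseʳ _ ⟩
    0#                                           ∎
    where
    open Homomorphism (MPoly commutativeRing n) commutativeRing (eval-hom n s)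
    open Ops n
    open SetoidReasoning setoid

  -- Divide by x₀^q − x₀: the coefficients of the remainder vanish identically,
  -- since as a polynomial in x₀ it has more roots than its degree.
  vanishing⇒∈ : ∀ n f → (∀ s → eval n f s ≈ 0#) →
                Ideals.Generated (MPoly commutativeRing n) (fieldEquation n) f
  vanishing⇒∈ zero    f v = Ideals.resp (sym (v (λ ()))) Ideals.nil
  vanishing⇒∈ (suc n) f v
    with UnivariateProperties.divide (MPoly commutativeRing n) (ℕ.<-trans ℕ.≤-refl 2<q) f
  ... | h , r , len , e = resp (≈ₚ-sym e) (add (mul h (gen zero))
    (coefficients-∈ n r λ k → vanishing⇒∈ n (coeff r k) (coefficient-vanishes k)))
    where
    open Ideals (MPoly commutativeRing (suc n)) using (gen; resp; add; mul)
    open Univariate (MPoly commutativeRing n)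
    open Univariate commutativeRing using () renaming (coeff to coeffᶠ; coeff-≈ to coeffᶠ-≈)
    open SetoidReasoning setoid

    r-vanishes : ∀ s → eval (suc n) r s ≈ 0#
    r-vanishes s = begin
      eval (suc n) r s
        ≈⟨ +-identityˡ _ ⟨
      0# + eval (suc n) r s
        ≈⟨ +-congʳ (trans (*-homo h (fieldEquation (suc n) zero))
             (trans (*-congˡ (fieldEquation-vanishes (suc n) zero s)) (zeroʳ _))) ⟨
      eval (suc n) (h *ₚ fieldEquation (suc n) zero) s + eval (suc n) r s
        ≈⟨ +-homo (h *ₚ fieldEquation (suc n) zero) r ⟨
      eval (suc n) (h *ₚ fieldEquation (suc n) zero +ₚ r) s
        ≈⟨ ⟦⟧-cong e ⟨
      eval (suc n) f s
        ≈⟨ v s ⟩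
      0# ∎
      where open Homomorphism (MPoly commutativeRing (suc n)) commutativeRing (eval-hom (suc n) s)

    module _ (t : Vector Carrier n) where
      specialize : List (Poly n) → List Carrier
      specialize = List.map (λ g → eval n g t)

      horner-specialize : ∀ g x → horner (specialize g) x ≈ eval (suc n) g (x Vec.∷ t)
      horner-specialize []      x = refl
      horner-specialize (a ∷ g) x = +-congˡ (*-congˡ (horner-specialize g x))

      coeff-specialize : ∀ g k → coeffᶠ (specialize g) k ≈ eval n (coeff g k) t
      coeff-specialize []      k       = sym (IsHom.0#-homo)
        where module IsHom = Homomorphism (MPoly commutativeRing n) commutativeRing (eval-hom n t)
      coeff-specialize (a ∷ g) zero    = refl
      coeff-specialize (a ∷ g) (suc k) = coeff-specialize g k

    coefficient-vanishes : ∀ k t → eval n (coeff r k) t ≈ 0#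
    coefficient-vanishes k t = trans (sym (coeff-specialize t r k)) (coeffᶠ-≈
      (vanishing⇒zero (specialize t r)
        (ℕ.≤-trans (ℕ.≤-reflexive (List.length-map _ r)) len)
        (λ x → trans (horner-specialize t r x) (r-vanishes (x Vec.∷ t)))) k)

  -- By Fermat the power is 0 where the coordinate equals `s i` and 1 elsewhere, so the factor is 1
  -- and 0 respectively.
  indicatorFactor : ∀ n → Vector Carrier n → Fin n → Poly n
  indicatorFactor n s i = 1ₚ ⊝ (var n i ⊝ const n (s i)) ⊛^ (q ℕ.∸ 1)
    where open Ops n

  indicator : ∀ n → Vector Carrier n → Poly n
  indicator n s = Ops.product n (indicatorFactor n s)

  module _ (n : ℕ) (s t : Vector Carrier n) where
    private
      factor : Fin n → Carrier
      factor i = 1# - (t i - s i) ^ (q ℕ.∸ 1)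

    eval-indicator : eval n (indicator n s) t ≈ product factor
    eval-indicator = trans (product-homo (indicatorFactor n s)) (Product.sum-cong-≋ {n} λ i →
      trans (∸-homo _ _) (+-cong 1#-homo (-‿cong (trans (^-homo _ (q ℕ.∸ 1))
        (^-congˡ (q ℕ.∸ 1) (trans (∸-homo _ _)
          (+-cong (eval-var n i t) (-‿cong (eval-const n (s i) t)))))))))
      where
      open Homomorphism (MPoly commutativeRing n) commutativeRing (eval-hom n t)

    indicator≈1 : (∀ i → t i ≈ s i) → eval n (indicator n s) t ≈ 1#
    indicator≈1 t≈s = trans eval-indicator (trans
      (Product.sum-cong-≋ {n} λ i → trans
        (+-congˡ (trans (-‿cong (0^q-1 F 2<q (x≈y⇒x∙y⁻¹≈ε (t≈s i)))) -0#≈0#)) (+-identityʳ 1#))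
      (Product.sum-replicate-zero n))

    indicator≈0 : ¬ (∀ i → t i ≈ s i) → eval n (indicator n s) t ≈ 0#
    indicator≈0 t≉s with Fin.¬∀⟶∃¬ n (λ i → t i ≈ s i) (λ i → t i ≟ s i) t≉s
    ... | i , tᵢ≉sᵢ = trans eval-indicator (zero-product factor i
      (trans (+-congˡ (-‿cong (fermat (tᵢ≉sᵢ ∘ x∙y⁻¹≈ε⇒x≈y (t i) (s i))))) (-‿inverseʳ 1#)))

  sum-single : ∀ {n} (v : Vector Carrier n) i → (∀ j → j ≢ i → v j ≈ 0#) → sum v ≈ v i
  sum-single {suc n} v i v≈0 = trans (sum-remove {i = i} v) (trans
    (+-congˡ (trans (sum-cong-≋ λ j → v≈0 (punchIn i j) (Fin.punchInᵢ≢i i j)) (sum-replicate-zero n)))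
    (+-identityʳ _))

-- Ideals that contain the field equations

module Nullstellensatz {q} (F : FiniteField c ℓ q) (2<q : 2 ℕ.< q) (n : ℕ)
  (I : Ideal (MPoly (FiniteField.commutativeRing F) n) p)
  (fieldEquation∈I : ∀ i → Ideal.Member I (FieldEquations.fieldEquation F 2<q n i))
  (dichotomy : Dichotomies.Dichotomy (FiniteField.commutativeRing F) n I)
  where
  open FiniteField F hiding (zero)
  open FiniteFieldProperties F
  open FieldEquations F 2<q
  open RingOps commutativeRing using (sum)
  open RingProperties ring using (x≈y⇒x∙y⁻¹≈ε; x∙y⁻¹≈ε⇒x≈y)
  open Sum semiring using (sum-cong-≋)
  open Multivariate commutativeRing
  open MultivariateEvaluation commutativeRing
  open OverFiniteField F using (module Ops)
  open Ops n renaming (sum to sumₚ)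
  open Ideals (MPoly commutativeRing n) using (_∈_; IsRadical; Generated; gen; resp; nil; add; mul)
  open Dichotomies commutativeRing n
  open SetoidReasoning setoid
  private
    module P = CommutativeRing (MPoly commutativeRing n)
    module I = Ideal I
    module Space = Inverse (vector-cardinality cardinality n)
    module _ (s : Vector Carrier n) where
      open Homomorphism (MPoly commutativeRing n) commutativeRing (eval-hom n s) public
    infix 10 _⟪_⟫
    _⟪_⟫ : Poly n → Vector Carrier n → Carrier
    f ⟪ s ⟫ = eval n f s

  vanishing⇒∈I : ∀ f → (∀ s → f ⟪ s ⟫ ≈ 0#) → f ∈ I
  vanishing⇒∈I f v = fieldIdeal⊆I (vanishing⇒∈ n f v)
    where
    fieldIdeal⊆I : ∀ {g} → Generated (fieldEquation n) g → g ∈ I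
    fieldIdeal⊆I (gen i)    = fieldEquation∈I i
    fieldIdeal⊆I (resp e h) = I.resp-≈ e (fieldIdeal⊆I h)
    fieldIdeal⊆I nil        = I.0∈
    fieldIdeal⊆I (add h k)  = I.+-closed (fieldIdeal⊆I h) (fieldIdeal⊆I k)
    fieldIdeal⊆I (mul r h)  = I.*-closed r (fieldIdeal⊆I h)

  -- Membership in I depends only on the function that a polynomial defines, since f - g vanishes at
  -- every point.
  agreeing⇒∈I : ∀ f g → g ∈ I → (∀ s → f ⟪ s ⟫ ≈ g ⟪ s ⟫) → f ∈ I
  agreeing⇒∈I f g g∈I e = I.resp-≈ cancel
    (I.+-closed (vanishing⇒∈I (f ⊝ g) λ s → trans (∸-homo s f g) (x≈y⇒x∙y⁻¹≈ε (e s))) g∈I)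
    where
    cancel : f ⊝ g P.+ g P.≈ f
    cancel = P.trans (P.+-assoc f (P.- g) g)
      (P.trans (P.+-congˡ {f} (P.-‿inverseˡ g)) (P.+-identityʳ f))

  sum-∈I : ∀ {k} (v : Vector (Poly n) k) → (∀ i → v i ∈ I) → sumₚ v ∈ I
  sum-∈I {zero}  v v∈ = I.0∈
  sum-∈I {suc k} v v∈ = I.+-closed (v∈ zero) (sum-∈I (v ∘ suc) (v∈ ∘ suc))

  module _ (f : Poly n) (f-vanishes : ∀ s → VanishesAt I s → f ⟪ s ⟫ ≈ 0#) where

    -- Off the zero set, the member g with g(s) ≠ 0 is multiplied by f(s)/g(s) and by the indicator
    -- of s: the first fixes the value at s, the second clears all other points.
    localize : ∀ s → ∃[ g ] g ∈ I × g ⟪ s ⟫ ≈ f ⟪ s ⟫ ×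
               (∀ t → ¬ (∀ i → t i ≈ s i) → g ⟪ t ⟫ ≈ 0#)
    localize s with dichotomy s
    -- At a zero of I the polynomial f vanishes by assumption, so 0 already has the right value.
    ... | inj₁ s∈Z = P.0# , I.0∈ , trans (0#-homo s) (sym (f-vanishes s s∈Z)) , λ t _ → 0#-homo t
    ... | inj₂ (g , g∈I , gs≉0) with inverse (g ⟪ s ⟫) gs≉0
    ...   | gs⁻¹ , gs*gs⁻¹≈1 =
      r P.* g , I.*-closed r g∈I , at-s , away
      where
      scalar = f ⟪ s ⟫ * gs⁻¹
      r = const n scalar P.* indicator n s

      at-s : (r P.* g) ⟪ s ⟫ ≈ f ⟪ s ⟫
      at-s = begin
        (r P.* g) ⟪ s ⟫
          ≈⟨ trans (*-homo s r g) (*-congʳ (*-homo s _ _)) ⟩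
        const n scalar ⟪ s ⟫ * indicator n s ⟪ s ⟫ * g ⟪ s ⟫
          ≈⟨ *-congʳ (*-cong (eval-const n scalar s) (indicator≈1 n s s λ _ → refl)) ⟩
        f ⟪ s ⟫ * gs⁻¹ * 1# * g ⟪ s ⟫
          ≈⟨ *-congʳ (*-identityʳ _) ⟩
        f ⟪ s ⟫ * gs⁻¹ * g ⟪ s ⟫
          ≈⟨ *-assoc _ _ _ ⟩
        f ⟪ s ⟫ * (gs⁻¹ * g ⟪ s ⟫)
          ≈⟨ *-congˡ (trans (*-comm _ _) gs*gs⁻¹≈1) ⟩
        f ⟪ s ⟫ * 1#
          ≈⟨ *-identityʳ _ ⟩
        f ⟪ s ⟫ ∎

      away : ∀ t → ¬ (∀ i → t i ≈ s i) → (r P.* g) ⟪ t ⟫ ≈ 0#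
      away t t≉s = begin
        (r P.* g) ⟪ t ⟫
          ≈⟨ trans (*-homo t r g) (*-congʳ (*-homo t _ _)) ⟩
        const n scalar ⟪ t ⟫ * indicator n s ⟪ t ⟫ * g ⟪ t ⟫
          ≈⟨ *-congʳ (*-congˡ (indicator≈0 n s t t≉s)) ⟩
        const n scalar ⟪ t ⟫ * 0# * g ⟪ t ⟫
          ≈⟨ *-congʳ (zeroʳ _) ⟩
        0# * g ⟪ t ⟫
          ≈⟨ zeroˡ _ ⟩
        0# ∎

    -- The local pieces of all qⁿ points add up to a member of I with the values of f: at s, only
    -- the piece belonging to s survives.
    nullstellensatz : f ∈ I
    nullstellensatz = agreeing⇒∈I f (sumₚ local)
      (sum-∈I local λ k → proj₁ (proj₂ (localize (point k))))
      λ s → let k = Space.to s in sym (begin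
        sumₚ local ⟪ s ⟫             ≈⟨ sum-homo s local ⟩
        sum (λ j → local j ⟪ s ⟫)    ≈⟨ sum-single (λ j → local j ⟪ s ⟫) k (λ j j≢k →
                                          proj₂ (proj₂ (proj₂ (localize (point j)))) s
                                            (λ e → j≢k (≡.sym (Space.inverseˡ e)))) ⟩
        -- `point k` equals `s` only coordinatewise, so values are moved there and back.
        local k ⟪ s ⟫                ≈⟨ eval-cong-point n (local k) (Space.strictlyInverseʳ s) ⟨
        local k ⟪ point k ⟫          ≈⟨ proj₁ (proj₂ (proj₂ (localize (point k)))) ⟩
        f ⟪ point k ⟫                ≈⟨ eval-cong-point n f (Space.strictlyInverseʳ s) ⟩
        f ⟪ s ⟫                      ∎)
      where
      point = Space.from
      local : ∀ k → Poly n
      local k = proj₁ (localize (point k))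

  -- A field has no nonzero nilpotents, so f vanishes wherever its power does. For k = 0 the ideal
  -- contains 1 and has no zeros at all.
  isRadical : IsRadical I
  isRadical f k fᵏ∈I = nullstellensatz f λ s s∈Z →
    ^-zero _ k (trans (sym (^-homo s f k)) (s∈Z _ fᵏ∈I))

  zeros-cardinality : ∃ (HasCardinality (𝒵 commutativeRing n I))
  zeros-cardinality = subset-cardinality (vector-cardinality cardinality n)
    (λ s≈t s∈Z f f∈I → trans (eval-cong-point n f (λ i → sym (s≈t i))) (s∈Z f f∈I))
    decide
    where
    decide : Decidable (VanishesAt I)
    decide s with dichotomy s
    ... | inj₁ s∈Z = yes s∈Z
    ... | inj₂ (g , g∈I , gs≉0) = no λ s∈Z → gs≉0 (s∈Z g g∈I)

  module _ {k} (|Z|≡k : HasCardinality (𝒵 commutativeRing n I) k) where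
    private
      module Z = Inverse |Z|≡k
      zeroAt : Fin k → Vector Carrier n
      zeroAt = proj₁ ∘ Z.from

    basis : Vector (Poly n) k
    basis = indicator n ∘ zeroAt

    combination : Vector Carrier k → Poly n
    combination a = sumₚ λ i → const n (a i) ⊛ basis i

    -- The indicators of the zeros are dual to evaluation at the zeros. This yields independence and
    -- shows that the coordinates of f must be its values.
    combination-at-zero : ∀ a i → combination a ⟪ zeroAt i ⟫ ≈ a i
    combination-at-zero a i = begin
      combination a ⟪ zeroAt i ⟫
        ≈⟨ sum-homo (zeroAt i) (λ j → const n (a j) ⊛ basis j) ⟩
      sum (λ j → (const n (a j) ⊛ basis j) ⟪ zeroAt i ⟫)
        ≈⟨ sum-cong-≋ (λ j → trans (*-homo (zeroAt i) (const n (a j)) (basis j))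
                                   (*-congʳ (eval-const n (a j) (zeroAt i)))) ⟩
      sum (λ j → a j * basis j ⟪ zeroAt i ⟫)
        ≈⟨ sum-single _ i (λ j j≢i → trans (*-congˡ (indicator≈0 n (zeroAt j) (zeroAt i)
             λ e → j≢i (≡.sym (≡.trans (≡.sym (Z.strictlyInverseˡ i)) (Z.inverseˡ e)))))
             (zeroʳ _)) ⟩
      a i * basis i ⟪ zeroAt i ⟫
        ≈⟨ *-congˡ (indicator≈1 n (zeroAt i) (zeroAt i) λ _ → refl) ⟩
      a i * 1#
        ≈⟨ *-identityʳ _ ⟩
      a i ∎

    independent : ∀ a → combination a ⊝ P.0# ∈ I → ∀ i → a i ≈ 0#
    independent a e i = begin
      a i                            ≈⟨ combination-at-zero a i ⟨
      combination a ⟪ zeroAt i ⟫     ≈⟨ x∙y⁻¹≈ε⇒x≈y _ _ (trans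
                                          (sym (∸-homo (zeroAt i) (combination a) P.0#))
                                          (proj₂ (Z.from i) _ e)) ⟩
      P.0# ⟪ zeroAt i ⟫              ≈⟨ 0#-homo (zeroAt i) ⟩
      0#                             ∎

    coordinates : Poly n → Vector Carrier k
    coordinates f i = f ⟪ zeroAt i ⟫

    -- Lagrange interpolation on the zero set: the difference vanishes there and so lies in I.
    spanning : ∀ f → f ⊝ combination (coordinates f) ∈ I
    spanning f = nullstellensatz (f ⊝ combination v) λ s s∈Z →
      let i = Z.to (s , s∈Z)
          z≈s = Z.strictlyInverseʳ (s , s∈Z)
      in begin
      (f ⊝ combination v) ⟪ s ⟫
        ≈⟨ ∸-homo s f (combination v) ⟩
      f ⟪ s ⟫ - combination v ⟪ s ⟫
        ≈⟨ +-cong (eval-cong-point n f z≈s)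
                  (-‿cong (eval-cong-point n (combination v) z≈s)) ⟨
      f ⟪ zeroAt i ⟫ - combination v ⟪ zeroAt i ⟫
        ≈⟨ +-congˡ (-‿cong (combination-at-zero v i)) ⟩
      f ⟪ zeroAt i ⟫ - f ⟪ zeroAt i ⟫
        ≈⟨ -‿inverseʳ _ ⟩
      0# ∎
      where v = coordinates f

-- Permutation polynomials

cardinality-transport : ∀ {S : Setoid a ℓ₁} {T : Setoid b ℓ₂} {k} →
                        Bijection S T → HasCardinality S k → HasCardinality T k
cardinality-transport φ |S|≡k = Composition.inverse (Symmetry.inverse (Bijection⇒Inverse φ)) |S|≡k

module PermutationIdeals {q} (F : FiniteField c ℓ q) (2<q : 2 < q) where
  open FiniteField F hiding (zero)
  open FiniteFieldProperties F
  open FieldEquations F 2<q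
  open RingOps commutativeRing using (_^_; sum; product)
  open RingProperties ring using (x∙y⁻¹≈ε⇒x≈y; x≈y⇒x∙y⁻¹≈ε; -‿+-comm; -‿distribˡ-*)
  open Sum semiring using (sum-cong-≋; ∑-comm; *-distribˡ-sum; *-distribʳ-sum)
  open SemiringSolver commutativeSemiring using (solve; _:+_; _:*_; _:=_)
  open Multivariate commutativeRing
  open MultivariateEvaluation commutativeRing
  open OverFiniteField F
  private
    module ≈-Reasoning = SetoidReasoning setoid
    R = commutativeRing
    module R[x] = CommutativeRing (MPoly R 1)
    module R[x,y] = CommutativeRing (MPoly R 2)
    module U₁ = Univariate R
    module U₂ = Univariate (MPoly R 1)
    module P₁ = UnivariateProperties R
    module P₂ = UnivariateProperties (MPoly R 1)

  -- With powers of two field elements for `a` and `b`, this turns the sum inside a generator into a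
  -- difference of two values of one polynomial, so that its vanishing means a collision.
  sum-difference : ∀ {n} (a b s : Vector Carrier n) →
                   sum (λ i → (a i - b i) * s i) ≈ sum (λ i → s i * a i) - sum (λ i → s i * b i)
  sum-difference {zero}  a b s = sym (-‿inverseʳ 0#)
  sum-difference {suc n} a b s = let open ≈-Reasoning in begin
    (a₀ - b₀) * s₀ + sum (λ i → (a (suc i) - b (suc i)) * s (suc i))
      ≈⟨ +-cong (trans (distribʳ s₀ a₀ (- b₀)) (+-cong (*-comm a₀ s₀)
                  (trans (sym (-‿distribˡ-* b₀ s₀)) (-‿cong (*-comm b₀ s₀)))))
                (sum-difference (a ∘ suc) (b ∘ suc) (s ∘ suc)) ⟩
    (s₀ * a₀ - s₀ * b₀) + (A - B)
      ≈⟨ solve 4 (λ x y z w → (x :+ y) :+ (z :+ w) := (x :+ z) :+ (y :+ w))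
           refl (s₀ * a₀) (- (s₀ * b₀)) A (- B) ⟩
    (s₀ * a₀ + A) + (- (s₀ * b₀) - B)
      ≈⟨ +-congˡ (-‿+-comm (s₀ * b₀) B) ⟩
    (s₀ * a₀ + A) - (s₀ * b₀ + B) ∎
    where
    a₀ = a zero
    b₀ = b zero
    s₀ = s zero
    A = sum (λ i → s (suc i) * a (suc i))
    B = sum (λ i → s (suc i) * b (suc i))

  infixl 8 _⟨_∣_⟩ᵥ
  _⟨_∣_⟩ᵥ : ∀ {M N} → (Fin M → Fin N → Carrier) → Carrier → Carrier → Carrier
  c ⟨ x ∣ y ⟩ᵥ = (λ i → c i ⟨ y ⟩ᵥ) ⟨ x ⟩ᵥ

  ⟨⟩ᵥ-congˡ : ∀ {n} {s t : Vector Carrier n} x → (∀ i → s i ≈ t i) → s ⟨ x ⟩ᵥ ≈ t ⟨ x ⟩ᵥ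
  ⟨⟩ᵥ-congˡ {n} x e = sum-cong-≋ {n} λ i → *-congʳ (e i)

  ⟨∣⟩ᵥ-cong : ∀ {M N} (c : Fin M → Fin N → Carrier) {x x′ y y′} → x ≈ x′ → y ≈ y′ →
              c ⟨ x ∣ y ⟩ᵥ ≈ c ⟨ x′ ∣ y′ ⟩ᵥ
  ⟨∣⟩ᵥ-cong {M} c {x} {x′} {y} {y′} e e′ = trans
    (⟨⟩ᵥ-cong (λ i → c i ⟨ y ⟩ᵥ) e) (⟨⟩ᵥ-congˡ x′ λ i → ⟨⟩ᵥ-cong (c i) e′)

  -- Evaluation always nests y inside x, while the row generators have the varying variable y
  -- outside; exchanging the sums connects the two.
  ⟨∣⟩ᵥ-flip : ∀ {M N} (c : Fin M → Fin N → Carrier) x y → c ⟨ x ∣ y ⟩ᵥ ≈ flip c ⟨ y ∣ x ⟩ᵥ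
  ⟨∣⟩ᵥ-flip {M} {N} c x y = let open ≈-Reasoning in begin
    sum {M} (λ i → c i ⟨ y ⟩ᵥ * x ^ toℕ i)
      ≈⟨ sum-cong-≋ {M} (λ i → *-distribʳ-sum (x ^ toℕ i) (λ j → c i j * y ^ toℕ j)) ⟩
    sum {M} (λ i → sum {N} λ j → c i j * y ^ toℕ j * x ^ toℕ i)
      ≈⟨ ∑-comm {M} {N} (λ i j → c i j * y ^ toℕ j * x ^ toℕ i) ⟩
    sum {N} (λ j → sum {M} λ i → c i j * y ^ toℕ j * x ^ toℕ i)
      ≈⟨ sum-cong-≋ {N} (λ j → sum-cong-≋ {M} λ i →
           solve 3 (λ c y x → c :* y :* x := c :* x :* y) refl (c i j) (y ^ toℕ j) (x ^ toℕ i)) ⟩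
    sum {N} (λ j → sum {M} λ i → c i j * x ^ toℕ i * y ^ toℕ j)
      ≈⟨ sum-cong-≋ {N} (λ j → *-distribʳ-sum (y ^ toℕ j) (λ i → c i j * x ^ toℕ i)) ⟨
    sum {N} (λ j → flip c j ⟨ x ⟩ᵥ * y ^ toℕ j) ∎

  eval-tabulate : ∀ n {N} (v : Vector (Poly n) N) s →
                  eval (suc n) (List.tabulate v) s ≈ (λ i → eval n (v i) (Vec.tail s)) ⟨ Vec.head s ⟩ᵥ
  eval-tabulate n {zero}  v s = refl
  eval-tabulate n {suc N} v s = let open ≈-Reasoning in begin
    v₀ + x * eval (suc n) (List.tabulate (v ∘ suc)) s
      ≈⟨ +-cong (sym (*-identityʳ _)) (*-congˡ (eval-tabulate n (v ∘ suc) s)) ⟩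
    v₀ * 1# + x * (w ⟨ x ⟩ᵥ)
      ≈⟨ +-congˡ (*-distribˡ-sum x (λ i → w i * x ^ toℕ i)) ⟩
    v₀ * 1# + sum (λ i → x * (w i * x ^ toℕ i))
      ≈⟨ +-congˡ (sum-cong-≋ {N} λ i → solve 3 (λ x w y → x :* (w :* y) := w :* (x :* y))
           refl x (w i) (x ^ toℕ i)) ⟩
    (λ i → eval n (v i) (Vec.tail s)) ⟨ x ⟩ᵥ ∎
    where
    x = Vec.head s
    v₀ = eval n (v zero) (Vec.tail s)
    w : Vector Carrier N
    w i = eval n (v (suc i)) (Vec.tail s)

  tabulate₂ : ∀ {M N} → (Fin M → Fin N → Carrier) → Poly 2
  tabulate₂ c = List.tabulate λ i → List.tabulate (c i)

  eval-tabulate₁ : ∀ {N} (s : Vector Carrier N) t → eval 1 (List.tabulate s) t ≈ s ⟨ t zero ⟩ᵥ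
  eval-tabulate₁ s t = eval-tabulate 0 s t

  eval-tabulate₂ : ∀ {M N} (c : Fin M → Fin N → Carrier) t →
                   eval 2 (tabulate₂ c) t ≈ c ⟨ t zero ∣ t (suc zero) ⟩ᵥ
  eval-tabulate₂ c t = trans (eval-tabulate 1 (λ i → List.tabulate (c i)) t)
    (⟨⟩ᵥ-congˡ (t zero) λ i → eval-tabulate₁ (c i) (Vec.tail t))

  univariatePoly≈tabulate : ∀ s → univariatePoly s R[x].≈ List.tabulate s
  univariatePoly≈tabulate s = P₁.sum-monomials s

  entries : Vector Carrier nX̄ → Fin nX → Fin nX → Carrier
  entries s i j = s (combine i j)

  -- For fixed i the sum over j is x^i times a polynomial in y embedded as a constant, so
  -- `sum-monomials` applies first to y and then to x.
  bivariatePoly≈tabulate : ∀ s → bivariatePoly s R[x,y].≈ tabulate₂ (entries s)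
  bivariatePoly≈tabulate s = R[x,y].trans (sum-cong₂ row)
    (P₂.sum-monomials λ i → List.tabulate (entries s i))
    where
    open Sum R[x,y].semiring using () renaming (sum-cong-≋ to sum-cong₂; *-distribʳ-sum to *-distribʳ-sum₂)
    open SemiringSolver R[x,y].commutativeSemiring using ()
      renaming (solve to solve₂; _:*_ to _:*₂_; _:=_ to _:=₂_)
    open Homomorphism (MPoly R 1) (MPoly R 2) P₂.constant-hom
    open Ops 2 using (_⊛_; _⊛^_) renaming (sum to sum₂)
    open Ops 1 using () renaming (_⊛_ to _⊛₁_; _⊛^_ to _⊛^₁_; sum to sum₁)
    x = var 2 zero
    y = var 2 (suc zero)
    y₁ = var 1 zero
    row : ∀ i → sum₂ (λ j → const 2 (entries s i j) ⊛ (x ⊛^ toℕ i ⊛ y ⊛^ toℕ j)) R[x,y].≈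
                (List.tabulate (entries s i) ∷ []) ⊛ x ⊛^ toℕ i
    row i = begin
      sum₂ (λ j → const 2 (entries s i j) ⊛ (x ⊛^ toℕ i ⊛ y ⊛^ toℕ j))
        ≈⟨ sum-cong₂ (λ j → R[x,y].trans
              (solve₂ 3 (λ c x y → c :*₂ (x :*₂ y) :=₂ c :*₂ y :*₂ x)
                R[x,y].refl (const 2 (entries s i j)) (x ⊛^ toℕ i) (y ⊛^ toℕ j))
              (R[x,y].*-congʳ {x ⊛^ toℕ i} (R[x,y].sym (R[x,y].trans
                (*-homo (const 1 (entries s i j)) (y₁ ⊛^₁ toℕ j))
                (R[x,y].*-congˡ {const 2 (entries s i j)} (^-homo y₁ (toℕ j))))))) ⟩
      sum₂ (λ j → ((const 1 (entries s i j) ⊛₁ y₁ ⊛^₁ toℕ j) ∷ []) ⊛ x ⊛^ toℕ i)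
        ≈⟨ *-distribʳ-sum₂ (x ⊛^ toℕ i) (λ j → (const 1 (entries s i j) ⊛₁ y₁ ⊛^₁ toℕ j) ∷ []) ⟨
      sum₂ (λ j → (const 1 (entries s i j) ⊛₁ y₁ ⊛^₁ toℕ j) ∷ []) ⊛ x ⊛^ toℕ i
        ≈⟨ R[x,y].*-congʳ {x ⊛^ toℕ i} (sum-homo (λ j → const 1 (entries s i j) ⊛₁ y₁ ⊛^₁ toℕ j)) ⟨
      (sum₁ (λ j → const 1 (entries s i j) ⊛₁ y₁ ⊛^₁ toℕ j) ∷ []) ⊛ x ⊛^ toℕ i
        ≈⟨ R[x,y].*-congʳ {x ⊛^ toℕ i} (⟦⟧-cong (P₁.sum-monomials (entries s i))) ⟩
      (List.tabulate (entries s i) ∷ []) ⊛ x ⊛^ toℕ i ∎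
      where open SetoidReasoning R[x,y].setoid

  module _ (n : ℕ) (s : Vector Carrier n) where
    open Ops n
    open Homomorphism (MPoly R n) R (eval-hom n s)

    eval-F⟦⟧ : ∀ g → eval n F⟦ g ⟧ s ≈ eval n g s ^ (q ∸ 1) - 1#
    eval-F⟦⟧ g = trans (∸-homo (g ⊛^ (q ∸ 1)) 1ₚ) (+-cong (^-homo g (q ∸ 1)) (-‿cong 1#-homo))

    F⟦⟧≈0⇒≉0 : ∀ g → eval n F⟦ g ⟧ s ≈ 0# → ¬ eval n g s ≈ 0#
    F⟦⟧≈0⇒≉0 g e g≈0 = 1≉0 (trans
      (sym (x∙y⁻¹≈ε⇒x≈y _ _ (trans (sym (eval-F⟦⟧ g)) e))) (0^q-1 F 2<q g≈0))

    ≉0⇒F⟦⟧≈0 : ∀ g → ¬ eval n g s ≈ 0# → eval n F⟦ g ⟧ s ≈ 0#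
    ≉0⇒F⟦⟧≈0 g g≉0 = trans (eval-F⟦⟧ g) (x≈y⇒x∙y⁻¹≈ε (fermat g≉0))

    F⟦⟧≉0⇒≈0 : ∀ g → ¬ eval n F⟦ g ⟧ s ≈ 0# → eval n g s ≈ 0#
    F⟦⟧≉0⇒≈0 g e = Dec.decidable-stable (_ ≟ _) (e ∘ ≉0⇒F⟦⟧≈0 g)

    -- A padding factor 1 never vanishes, so a vanishing factor of `topProduct` reveals an index
    -- pair on the diagonal i + j = d together with a nonzero entry.
    if-F⟦⟧≈0 : ∀ {A : Set} (A? : Dec A) g →
               eval n (if does A? then F⟦ g ⟧ else 1ₚ) s ≈ 0# → A × ¬ eval n g s ≈ 0#
    if-F⟦⟧≈0 (yes x) g e = x , F⟦⟧≈0⇒≉0 g e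
    if-F⟦⟧≈0 (no _)  g e = contradiction (trans (sym 1#-homo) e) 1≉0

    ≈0-if-F⟦⟧ : ∀ {A : Set} (A? : Dec A) g → A → ¬ eval n g s ≈ 0# →
                eval n (if does A? then F⟦ g ⟧ else 1ₚ) s ≈ 0#
    ≈0-if-F⟦⟧ (yes _) g _ e = ≉0⇒F⟦⟧≈0 g e
    ≈0-if-F⟦⟧ (no ¬x) g x _ = contradiction x ¬x

    open Dichotomies R n using (VanishesAt; generators-vanish)
    open Ideals (MPoly R n) using (gen; _∈_)

    -- A search for a single generator that does not vanish is enough: a hit is the witness, and
    -- otherwise the whole ideal vanishes.
    dichotomy-at : {G : Set ι} (g : G → Poly n) → Dec (∃[ i ] ¬ eval n (g i) s ≈ 0#) →
                   VanishesAt ⟨ g ⟩ s ⊎ ∃[ f ] (f ∈ ⟨ g ⟩ × ¬ eval n f s ≈ 0#)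
    dichotomy-at g (yes (i , gᵢ≉0)) = inj₂ (g i , gen i , gᵢ≉0)
    dichotomy-at g (no none) = inj₁ (generators-vanish g s λ i →
      Dec.decidable-stable (_ ≟ _) λ gᵢ≉0 → none (i , gᵢ≉0))

  -- The generators are indexed by field elements bundled with proofs of distinctness, which cannot
  -- be enumerated directly. The search runs over `Fin q` instead and is transported through
  -- `element` and `index`. The first argument of `f` is the value of the fixed variable.
  collision? : (f : Carrier → Carrier → Carrier) →
               (∀ {e e′ x x′} → e ≈ e′ → x ≈ x′ → f e x ≈ f e′ x′) →
               Dec (Σ[ ((((x , y) , _) , e)) ∈ Distinct × Carrier ] f e x ≈ f e y)
  collision? f f-cong = Dec.map′
    (λ (i , j , k , x≉y , e) → (((element i , element j) , x≉y) , element k) , e)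
    (λ ((((x , y) , x≉y) , e) , eq) → index x , index y , index e
      , (λ x≈y → x≉y (trans (sym (element-index x)) (trans x≈y (element-index y))))
      , trans (f-cong (element-index e) (element-index x))
              (trans eq (sym (f-cong (element-index e) (element-index y)))))
    (Fin.any? λ i → Fin.any? λ j → Fin.any? λ k →
      ¬? (element i ≟ element j) ×-dec (f (element k) (element i) ≟ f (element k) (element j)))

  collisionFree⇒injective : ∀ {f : Carrier → Carrier} →
    (∀ {x y} → ¬ x ≈ y → ¬ f x ≈ f y) → Injective _≈_ _≈_ f
  collisionFree⇒injective free {x} {y} e = Dec.decidable-stable (x ≟ y) λ x≉y → free x≉y e

  difference-≉0 : ∀ {x y z} → z ≈ x - y → ¬ x ≈ y → ¬ z ≈ 0#
  difference-≉0 e x≉y z≈0 = x≉y (x∙y⁻¹≈ε⇒x≈y _ _ (trans (sym e) z≈0))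

  difference-≈0 : ∀ {x y z} → z ≈ x - y → x ≈ y → z ≈ 0#
  difference-≈0 e x≈y = trans e (x≈y⇒x∙y⁻¹≈ε x≈y)

  suc-nX≡q : suc nX ≡ q
  suc-nX≡q = ℕ.m+[n∸m]≡n {1} {q} (ℕ.<-trans (s≤s z≤n) 2<q)

  nX<q : nX < q
  nX<q = ℕ.≤-reflexive suc-nX≡q

  -- Permutation polynomials in one variable as zeros

  module Univariate-𝒫 where
    open Ops nX using (F⟦_⟧; ⟨_⟩; _⊕_; _⊛_) renaming (sum to sumₚ)
    open Dichotomies R nX
    private
      x : Fin nX → Poly nX
      x = var nX

    Fgen-inner : Carrier → Carrier → Poly nX
    Fgen-inner a b = sumₚ λ i → const nX (a ^ toℕ i - b ^ toℕ i) ⊛ x i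

    eval-Fgen-inner : ∀ s a b → eval nX (Fgen-inner a b) s ≈ s ⟨ a ⟩ᵥ - s ⟨ b ⟩ᵥ
    eval-Fgen-inner s a b = trans (sum-homo λ i → const nX (a ^ toℕ i - b ^ toℕ i) ⊛ x i) (trans
      (sum-cong-≋ {nX} λ i → trans (*-homo (const nX (a ^ toℕ i - b ^ toℕ i)) (x i))
        (*-cong (eval-const nX _ s) (eval-var nX i s)))
      (sum-difference (λ i → a ^ toℕ i) (λ i → b ^ toℕ i) s))
      where open Homomorphism (MPoly R nX) R (eval-hom nX s)

    private
      point : Carrier → Vector Carrier 1
      point a = a Vec.∷ Vec.[]

    coefficients : Poly 1 → Vector Carrier nX
    coefficients f i = U₁.coeff f (toℕ i)

    -- A point has coordinates for the exponents up to q - 2 only, so surjectivity onto 𝒫 depends on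
    -- this. The degree bound leaves just the exponent q - 1, which `permutation⇒top≈0` removes.
    permutation≈tabulate : ∀ f → IsPermutationPolynomial f → f R[x].≈ List.tabulate (coefficients f)
    permutation≈tabulate f (deg , inj , _) = P₁.tabulate-coeff nX f high
      where
      s : Vector Carrier q
      s i = U₁.coeff f (toℕ i)

      below-q : ∀ k → q ≤ k → U₁.coeff f k ≈ 0#
      below-q k q≤k = deg (λ _ → k) q≤k

      eval-f≈s : ∀ a → eval 1 f (point a) ≈ s ⟨ a ⟩ᵥ
      eval-f≈s a = trans (⟦⟧-cong (P₁.tabulate-coeff q f below-q)) (eval-tabulate₁ s (point a))
        where open Homomorphism (MPoly R 1) R (eval-hom 1 (point a))

      high : ∀ k → nX ≤ k → U₁.coeff f k ≈ 0#
      high k nX≤k with ℕ.m≤n⇒m<n∨m≡n nX≤k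
      ... | inj₁ nX<k   = below-q k (≡.subst (_≤ k) suc-nX≡q nX<k)
      ... | inj₂ ≡.refl = ≡.subst (λ k → U₁.coeff f k ≈ 0#) (Fin.toℕ-fromℕ< nX<q)
        (permutation⇒top≈0 F 2<q s (λ {a} {b} e → inj (trans (eval-f≈s a) (trans e (sym (eval-f≈s b)))))
          (fromℕ< nX<q) (Fin.toℕ-fromℕ< nX<q))

    module OfDegree (d : Fin nX) where
      private
        degreeGen : (∃[ i ] toℕ d < toℕ i) → Poly nX
        degreeGen (i , _) = x i
        topGen : ⊤ → Poly nX
        topGen _ = F⟦ x d ⟧
        I₂ = ℐ ⊕ ⟨ degreeGen ⟩
        open Ideals (MPoly R nX) using (gen; _∈_)

      fieldEquation∈ : ∀ i → fieldEquation nX i ∈ ℐ[ d ]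
      fieldEquation∈ i = ∈-⊕ˡ I₂ ⟨ topGen ⟩ (∈-⊕ˡ ℐ ⟨ degreeGen ⟩
        (∈-⊕ʳ ⟨ Fgen ⟩ ⟨ fieldEquation nX ⟩ (gen i)))

      dichotomy : Dichotomy ℐ[ d ]
      dichotomy = Dichotomy-⊕ I₂ ⟨ topGen ⟩
        (Dichotomy-⊕ ℐ ⟨ degreeGen ⟩
          (Dichotomy-⊕ ⟨ Fgen ⟩ ⟨ fieldEquation nX ⟩
            (λ s → dichotomy-at nX s Fgen (Dec.map′
              (λ ((((a , b) , a≉b) , _) , e) → ((a , b) , a≉b) , λ v →
                F⟦⟧≈0⇒≉0 nX s (Fgen-inner a b) v (difference-≈0 (eval-Fgen-inner s a b) e))
              -- `0#` is an arbitrary value for the fixed variable of `collision?`: with one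
              -- variable nothing is held fixed.
              (λ (((a , b) , a≉b) , v≉0) → (((a , b) , a≉b) , 0#) ,
                x∙y⁻¹≈ε⇒x≈y _ _ (trans (sym (eval-Fgen-inner s a b))
                  (F⟦⟧≉0⇒≈0 nX s (Fgen-inner a b) v≉0)))
              (collision? (λ _ → s ⟨_⟩ᵥ) (λ _ → ⟨⟩ᵥ-cong s))))
            (λ s → inj₁ (generators-vanish (fieldEquation nX) s λ i → fieldEquation-vanishes nX i s)))
          (λ s → dichotomy-at nX s degreeGen (Dec.map′
            (λ (i , d<i , v) → (i , d<i) , v) (λ ((i , d<i) , v) → i , d<i , v)
            (Fin.any? λ i → (toℕ d ℕ.<? toℕ i) ×-dec ¬? (eval nX (x i) s ≟ 0#)))))
        (λ s → dichotomy-at nX s topGen (Dec.map′ (tt ,_) proj₂ (¬? (eval nX (topGen tt) s ≟ 0#))))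

      open Nullstellensatz F 2<q nX ℐ[ d ] fieldEquation∈ dichotomy public
        using (isRadical; zeros-cardinality; basis; independent; coordinates; spanning)

      -- The common ground between zeros of the ideal and members of 𝒫. Injectivity is all that the
      -- generators express; surjectivity is recovered by finiteness.
      record IsPermutationVector (s : Vector Carrier nX) : Set (c ⊔ ℓ) where
        field
          injective : Injective _≈_ _≈_ (s ⟨_⟩ᵥ)
          degree≤d  : ∀ i → toℕ d < toℕ i → s i ≈ 0#
          top≉0     : ¬ s d ≈ 0#

      zero⇒permutation : ∀ s → VanishesAt ℐ[ d ] s → IsPermutationVector s
      zero⇒permutation s s∈Z = record
        { injective = collisionFree⇒injective λ {a} {b} a≉b e →
            F⟦⟧≈0⇒≉0 nX s (Fgen-inner a b)
              (s∈Z _ (∈-⊕ˡ I₂ ⟨ topGen ⟩ (∈-⊕ˡ ℐ ⟨ degreeGen ⟩ (∈-⊕ˡ ⟨ Fgen ⟩ ⟨ fieldEquation nX ⟩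
                (gen ((a , b) , a≉b))))))
              (difference-≈0 (eval-Fgen-inner s a b) e)
        ; degree≤d = λ i d<i → trans (sym (eval-var nX i s))
            (s∈Z _ (∈-⊕ˡ I₂ ⟨ topGen ⟩ (∈-⊕ʳ ℐ ⟨ degreeGen ⟩ (gen (i , d<i)))))
        ; top≉0 = λ e → F⟦⟧≈0⇒≉0 nX s (x d) (s∈Z _ (∈-⊕ʳ I₂ ⟨ topGen ⟩ (gen tt)))
            (trans (eval-var nX d s) e)
        }

      permutation⇒zero : ∀ s → IsPermutationVector s → VanishesAt ℐ[ d ] s
      permutation⇒zero s perm = VanishesAt-⊕ I₂ ⟨ topGen ⟩
        (VanishesAt-⊕ ℐ ⟨ degreeGen ⟩
          (VanishesAt-⊕ ⟨ Fgen ⟩ ⟨ fieldEquation nX ⟩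
            (generators-vanish Fgen s λ ((a , b) , a≉b) → ≉0⇒F⟦⟧≈0 nX s (Fgen-inner a b)
              (difference-≉0 (eval-Fgen-inner s a b) (a≉b ∘ injective)))
            (generators-vanish (fieldEquation nX) s λ i → fieldEquation-vanishes nX i s))
          (generators-vanish degreeGen s λ (i , d<i) → trans (eval-var nX i s) (degree≤d i d<i)))
        (generators-vanish topGen s λ _ → ≉0⇒F⟦⟧≈0 nX s (x d) (top≉0 ∘ trans (sym (eval-var nX d s))))
        where open IsPermutationVector perm

      module _ (s : Vector Carrier nX) (f : Poly 1) (f≈s : f R[x].≈ List.tabulate s) where

        eval-f : ∀ t → eval 1 f t ≈ s ⟨ t zero ⟩ᵥ
        eval-f t = trans (⟦⟧-cong f≈s) (eval-tabulate₁ s t)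
          where open Homomorphism (MPoly R 1) R (eval-hom 1 t)

        coeff-f : ∀ i → U₁.coeff f (toℕ i) ≈ s i
        coeff-f i = trans (U₁.coeff-≈ f≈s (toℕ i)) (P₁.coeff-tabulate s i)

        coeff-f-≥ : ∀ {k} → nX ≤ k → U₁.coeff f k ≈ 0#
        coeff-f-≥ l = trans (U₁.coeff-≈ f≈s _) (P₁.coeff-tabulate-≥ s l)

        -- `f` is any polynomial with coefficients `s`: here it will be `univariatePoly s`, while in
        -- the converse below it is an arbitrary member of 𝒫.
        permutation⇒𝒫 : IsPermutationVector s → IsPermutationPolynomial f × HasTotalDegree 1 f (toℕ d)
        permutation⇒𝒫 perm =
          ( (λ m q≤m → coeff-f-≥ (ℕ.≤-trans (ℕ.m∸n≤m q 1) q≤m))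
          , inj , injective⇒surjective (λ {a} {b} e → eval-cong-point 1 f {point a} {point b} λ { zero → e }) inj)
          , ((λ _ → toℕ d) , ℕ.+-identityʳ _ , λ e → top≉0 (trans (sym (coeff-f d)) e))
          , λ m d<m → high (m zero) (ℕ.<-≤-trans d<m (ℕ.≤-reflexive (ℕ.+-identityʳ (m zero))))
          where
          open IsPermutationVector perm
          inj : Injective _≈_ _≈_ (λ a → eval 1 f (point a))
          inj {a} {b} e = injective (trans (sym (eval-f (point a))) (trans e (eval-f (point b))))
          high : ∀ k → toℕ d < k → U₁.coeff f k ≈ 0#
          high k d<k with k ℕ.<? nX
          ... | no k≮ = coeff-f-≥ (ℕ.≮⇒≥ k≮)
          ... | yes k< = ≡.subst (λ k → U₁.coeff f k ≈ 0#) (Fin.toℕ-fromℕ< k<)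
            (trans (coeff-f (fromℕ< k<)) (degree≤d _ (ℕ.<-≤-trans d<k (ℕ.≤-reflexive (≡.sym (Fin.toℕ-fromℕ< k<))))))

        𝒫⇒permutation : IsPermutationPolynomial f → HasTotalDegree 1 f (toℕ d) → IsPermutationVector s
        𝒫⇒permutation (_ , inj , _) ((m , m≡d , fₘ≉0) , high) = record
          { injective = λ {a} {b} e → inj (trans (eval-f (point a)) (trans e (sym (eval-f (point b)))))
          ; degree≤d = λ i d<i → trans (sym (coeff-f i))
              (high (λ _ → toℕ i) (ℕ.<-≤-trans d<i (ℕ.≤-reflexive (≡.sym (ℕ.+-identityʳ (toℕ i))))))
          ; top≉0 = λ e → fₘ≉0 (≡.subst (λ k → U₁.coeff f k ≈ 0#)
              (≡.trans (≡.sym m≡d) (ℕ.+-identityʳ (m zero))) (trans (coeff-f d) e))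
          }

      zeros⤖𝒫 : Bijection (𝒵 R nX ℐ[ d ]) (𝒫 (toℕ d))
      zeros⤖𝒫 = record
        { to = λ (s , s∈Z) → univariatePoly s ,
            permutation⇒𝒫 s (univariatePoly s) (univariatePoly≈tabulate s) (zero⇒permutation s s∈Z)
        ; cong = λ {(s , _)} {(t , _)} s≈t → R[x].trans (univariatePoly≈tabulate s)
            (R[x].trans (P₁.tabulate-cong s≈t) (R[x].sym (univariatePoly≈tabulate t)))
        ; bijective =
            (λ {(s , _)} {(t , _)} e i → trans
              (sym (coeff-f s (univariatePoly s) (univariatePoly≈tabulate s) i))
              (trans (U₁.coeff-≈ e (toℕ i)) (coeff-f t (univariatePoly t) (univariatePoly≈tabulate t) i)))
          , λ (f , perm , total) → let f≈ = permutation≈tabulate f perm in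
              (coefficients f , permutation⇒zero _ (𝒫⇒permutation _ f f≈ perm total))
              , λ {(s , _)} e → R[x].trans (univariatePoly≈tabulate s)
                  (R[x].trans (P₁.tabulate-cong e) (R[x].sym f≈))
        }

  -- Local permutation polynomials in two variables as zeros

  module Bivariate-ℒ𝒫 where
    open Ops nX̄ using (F⟦_⟧; ⟨_⟩; _⊕_; _⊛_; 1ₚ) renaming (sum to sumₚ; product to productₚ)
    open Dichotomies R nX̄
    open Ideals (MPoly R nX̄) using (gen; _∈_)
    private
      x : Fin nX → Fin nX → Poly nX̄
      x i j = var nX̄ (combine i j)

    -- The placement `z` is `combine` for the column generators and `flip combine` for the row
    -- generators, so one computation serves both.
    G-inner : (Fin nX → Fin nX → Fin nX̄) → Carrier → Carrier → Carrier → Poly nX̄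
    G-inner z a b e = sumₚ λ i → sumₚ λ j →
      const nX̄ ((a ^ toℕ i - b ^ toℕ i) * e ^ toℕ j) ⊛ var nX̄ (z i j)

    eval-G-inner : ∀ s z a b e → let c = λ i j → s (z i j) in
                   eval nX̄ (G-inner z a b e) s ≈ c ⟨ a ∣ e ⟩ᵥ - c ⟨ b ∣ e ⟩ᵥ
    eval-G-inner s z a b e = let open ≈-Reasoning in begin
      eval nX̄ (G-inner z a b e) s
        ≈⟨ sum-homo (λ i → sumₚ λ j → const nX̄ (scalar i j) ⊛ var nX̄ (z i j)) ⟩
      sum (λ i → eval nX̄ (sumₚ λ j → const nX̄ (scalar i j) ⊛ var nX̄ (z i j)) s)
        ≈⟨ sum-cong-≋ {nX} (λ i → trans
             (sum-homo λ j → const nX̄ (scalar i j) ⊛ var nX̄ (z i j))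
             (sum-cong-≋ {nX} λ j → trans (*-homo (const nX̄ (scalar i j)) (var nX̄ (z i j)))
               (*-cong (eval-const nX̄ (scalar i j) s) (eval-var nX̄ (z i j) s)))) ⟩
      sum {nX} (λ i → sum {nX} λ j → (a ^ toℕ i - b ^ toℕ i) * e ^ toℕ j * s (z i j))
        ≈⟨ sum-cong-≋ {nX} (λ i → trans
             (sum-cong-≋ {nX} λ j → solve 3 (λ d e s → d :* e :* s := d :* (s :* e))
               refl (a ^ toℕ i - b ^ toℕ i) (e ^ toℕ j) (s (z i j)))
             (sym (*-distribˡ-sum (a ^ toℕ i - b ^ toℕ i) (λ j → s (z i j) * e ^ toℕ j)))) ⟩
      sum (λ i → (a ^ toℕ i - b ^ toℕ i) * (λ j → s (z i j)) ⟨ e ⟩ᵥ)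
        ≈⟨ sum-difference (λ i → a ^ toℕ i) (λ i → b ^ toℕ i) (λ i → (λ j → s (z i j)) ⟨ e ⟩ᵥ) ⟩
      (λ i j → s (z i j)) ⟨ a ∣ e ⟩ᵥ - (λ i j → s (z i j)) ⟨ b ∣ e ⟩ᵥ ∎
      where
      open Homomorphism (MPoly R nX̄) R (eval-hom nX̄ s)
      scalar : Fin nX → Fin nX → Carrier
      scalar i j = (a ^ toℕ i - b ^ toℕ i) * e ^ toℕ j

    private
      point : Carrier → Carrier → Vector Carrier 2
      point a b = a Vec.∷ b Vec.∷ Vec.[]

      exponents : ℕ → ℕ → Vector ℕ 2
      exponents k l = k Vec.∷ l Vec.∷ Vec.[]

    coefficientAt : Poly 2 → ℕ → ℕ → Carrier
    coefficientAt f k l = U₁.coeff (U₂.coeff f k) l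

    tabulate₂-cong : ∀ {M N} {c c′ : Fin M → Fin N → Carrier} → (∀ i j → c i j ≈ c′ i j) →
                     tabulate₂ c R[x,y].≈ tabulate₂ c′
    tabulate₂-cong e = P₂.tabulate-cong λ i → P₁.tabulate-cong (e i)

    tabulate₂-coefficientAt : ∀ n f → (∀ k l → n ≤ k ⊎ n ≤ l → coefficientAt f k l ≈ 0#) →
      f R[x,y].≈ tabulate₂ {n} {n} (λ i j → coefficientAt f (toℕ i) (toℕ j))
    tabulate₂-coefficientAt n f high = R[x,y].trans
      (P₂.tabulate-coeff n f λ k n≤k → U₁.coeffwise λ l → high k l (inj₁ n≤k))
      (P₂.tabulate-cong {n} λ i → P₁.tabulate-coeff n (U₂.coeff f (toℕ i)) λ l n≤l →
        high (toℕ i) l (inj₂ n≤l))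

    coefficients : Poly 2 → Vector Carrier nX̄
    coefficients f k = let (i , j) = remQuot {nX} nX k in coefficientAt f (toℕ i) (toℕ j)

    -- Fix y: f(x, y) permutes the field, so its coefficient of x^(q-1) is 0. That coefficient is a
    -- polynomial in y of degree below q that vanishes at every y, hence it is zero and the last row
    -- disappears. Exchanging the variables removes the last column.
    localPermutation≈tabulate : ∀ f → IsLocalPermutationPolynomial f →
                                f R[x,y].≈ tabulate₂ (entries (coefficients f))
    localPermutation≈tabulate f (degˣ , degʸ , bij) = R[x,y].trans
      (tabulate₂-coefficientAt nX f high)
      (tabulate₂-cong λ i j → reflexive (≡.sym (≡.cong
        (λ (i , j) → coefficientAt f (toℕ i) (toℕ j)) (Fin.remQuot-combine {nX} {nX} i j))))
      where
      c′ : Fin q → Fin q → Carrier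
      c′ i j = coefficientAt f (toℕ i) (toℕ j)

      below-q : ∀ k l → q ≤ k ⊎ q ≤ l → coefficientAt f k l ≈ 0#
      below-q k l (inj₁ q≤k) = degˣ (exponents k l) q≤k
      below-q k l (inj₂ q≤l) = degʸ (exponents k l) q≤l

      eval-f≈c : ∀ a b → eval 2 f (point a b) ≈ c′ ⟨ a ∣ b ⟩ᵥ
      eval-f≈c a b = trans (⟦⟧-cong (tabulate₂-coefficientAt q f below-q)) (eval-tabulate₂ c′ (point a b))
        where open Homomorphism (MPoly R 2) R (eval-hom 2 (point a b))

      last : Fin q
      last = fromℕ< nX<q

      lastRow≈0 : ∀ j → c′ last j ≈ 0#
      lastRow≈0 = ⟨⟩ᵥ-vanishing (c′ last) λ y → permutation⇒top≈0 F 2<q (λ i → c′ i ⟨ y ⟩ᵥ)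
        (λ {a} {b} e → proj₁ (proj₁ (bij y)) (trans (eval-f≈c a y) (trans e (sym (eval-f≈c b y)))))
        last (Fin.toℕ-fromℕ< nX<q)

      lastColumn≈0 : ∀ i → c′ i last ≈ 0#
      lastColumn≈0 = ⟨⟩ᵥ-vanishing (flip c′ last) λ x → permutation⇒top≈0 F 2<q (λ j → flip c′ j ⟨ x ⟩ᵥ)
        (λ {a} {b} e → proj₁ (proj₂ (bij x)) (trans (flipped x a) (trans e (sym (flipped x b)))))
        last (Fin.toℕ-fromℕ< nX<q)
        where
        flipped : ∀ x y → eval 2 f (point x y) ≈ flip c′ ⟨ y ∣ x ⟩ᵥ
        flipped x y = trans (eval-f≈c x y) (⟨∣⟩ᵥ-flip c′ x y)

      high : ∀ k l → nX ≤ k ⊎ nX ≤ l → coefficientAt f k l ≈ 0#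
      high k l nX≤ with k ℕ.<? q | l ℕ.<? q
      ... | no k≮q | _ = below-q k l (inj₁ (ℕ.≮⇒≥ k≮q))
      ... | yes _ | no l≮q = below-q k l (inj₂ (ℕ.≮⇒≥ l≮q))
      ... | yes k<q | yes l<q = ≡.subst₂ (λ k l → coefficientAt f k l ≈ 0#)
        (Fin.toℕ-fromℕ< k<q) (Fin.toℕ-fromℕ< l<q) (edge nX≤)
        where
        i = fromℕ< k<q
        j = fromℕ< l<q
        last≡ : ∀ {k} (k<q : k < q) → nX ≤ k → last ≡ fromℕ< k<q
        last≡ k<q nX≤k = Fin.fromℕ<-cong _ _
          (ℕ.≤-antisym nX≤k (ℕ.≤-pred (≡.subst (_ <_) (≡.sym suc-nX≡q) k<q))) nX<q k<q
        edge : nX ≤ k ⊎ nX ≤ l → c′ i j ≈ 0#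
        edge (inj₁ nX≤k) = ≡.subst (λ i → c′ i j ≈ 0#) (last≡ k<q nX≤k) (lastRow≈0 j)
        edge (inj₂ nX≤l) = ≡.subst (λ j → c′ i j ≈ 0#) (last≡ l<q nX≤l) (lastColumn≈0 i)

    module OfDegree (d : ℕ) where
      private
        fieldGen : Fin nX × Fin nX → Poly nX̄
        fieldGen (i , j) = fieldEquation nX̄ (combine i j)
        degreeGen : (∃₂ λ (i j : Fin nX) → d < toℕ i ℕ.+ toℕ j) → Poly nX̄
        degreeGen (i , j , _) = x i j
        topGen : ⊤ → Poly nX̄
        topGen _ = topProduct d
        G : (Distinct × Carrier) ⊎ (Distinct × Carrier) → Poly nX̄
        G = [ Grow , Gcol ]
        J₂ = 𝒥 ⊕ ⟨ degreeGen ⟩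

      module _ (s : Vector Carrier nX̄) where
        private
          c′ = entries s

        -- A row generator compares f(e, a) with f(e, b), so it controls injectivity in y; this is
        -- why the transposed matrix appears.
        row-collision⇒≉0 : ∀ {a b} (a≉b : ¬ a ≈ b) e → flip c′ ⟨ a ∣ e ⟩ᵥ ≈ flip c′ ⟨ b ∣ e ⟩ᵥ →
                           ¬ eval nX̄ (Grow (((a , b) , a≉b) , e)) s ≈ 0#
        row-collision⇒≉0 {a} {b} a≉b e eq v = F⟦⟧≈0⇒≉0 nX̄ s (G-inner (flip combine) a b e) v
          (difference-≈0 (eval-G-inner s (flip combine) a b e) eq)

        col-collision⇒≉0 : ∀ {a b} (a≉b : ¬ a ≈ b) e → c′ ⟨ a ∣ e ⟩ᵥ ≈ c′ ⟨ b ∣ e ⟩ᵥ →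
                           ¬ eval nX̄ (Gcol (((a , b) , a≉b) , e)) s ≈ 0#
        col-collision⇒≉0 {a} {b} a≉b e eq v = F⟦⟧≈0⇒≉0 nX̄ s (G-inner combine a b e) v
          (difference-≈0 (eval-G-inner s combine a b e) eq)

        row-≉0⇒collision : ∀ {a b} (a≉b : ¬ a ≈ b) e →
                           ¬ eval nX̄ (Grow (((a , b) , a≉b) , e)) s ≈ 0# →
                           flip c′ ⟨ a ∣ e ⟩ᵥ ≈ flip c′ ⟨ b ∣ e ⟩ᵥ
        row-≉0⇒collision {a} {b} a≉b e v = x∙y⁻¹≈ε⇒x≈y _ _ (trans
          (sym (eval-G-inner s (flip combine) a b e)) (F⟦⟧≉0⇒≈0 nX̄ s (G-inner (flip combine) a b e) v))

        col-≉0⇒collision : ∀ {a b} (a≉b : ¬ a ≈ b) e →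
                           ¬ eval nX̄ (Gcol (((a , b) , a≉b) , e)) s ≈ 0# →
                           c′ ⟨ a ∣ e ⟩ᵥ ≈ c′ ⟨ b ∣ e ⟩ᵥ
        col-≉0⇒collision {a} {b} a≉b e v = x∙y⁻¹≈ε⇒x≈y _ _ (trans
          (sym (eval-G-inner s combine a b e)) (F⟦⟧≉0⇒≈0 nX̄ s (G-inner combine a b e) v))

        fieldGen-vanishes : VanishesAt ⟨ fieldGen ⟩ s
        fieldGen-vanishes = generators-vanish fieldGen s λ (i , j) → fieldEquation-vanishes nX̄ (combine i j) s

      -- The ideal indexes its field equations by pairs, and every variable is `combine i j` for
      -- some pair.
      fieldEquation∈ : ∀ k → fieldEquation nX̄ k ∈ 𝒥[ d ]
      fieldEquation∈ k with Fin.combine-surjective {nX} {nX} k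
      ... | i , j , ≡.refl = ∈-⊕ˡ J₂ ⟨ topGen ⟩ (∈-⊕ˡ 𝒥 ⟨ degreeGen ⟩
        (∈-⊕ʳ ⟨ G ⟩ ⟨ fieldGen ⟩ (gen (i , j))))

      dichotomy : Dichotomy 𝒥[ d ]
      dichotomy = Dichotomy-⊕ J₂ ⟨ topGen ⟩
        (Dichotomy-⊕ 𝒥 ⟨ degreeGen ⟩
          (Dichotomy-⊕ ⟨ G ⟩ ⟨ fieldGen ⟩
            (λ s → dichotomy-at nX̄ s G (Dec.map′
              (λ { (inj₁ ((((a , b) , a≉b) , e) , eq)) →
                     inj₁ (((a , b) , a≉b) , e) , row-collision⇒≉0 s a≉b e eq
                 ; (inj₂ ((((a , b) , a≉b) , e) , eq)) →
                     inj₂ (((a , b) , a≉b) , e) , col-collision⇒≉0 s a≉b e eq })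
              (λ { (inj₁ (((a , b) , a≉b) , e) , v) →
                     inj₁ ((((a , b) , a≉b) , e) , row-≉0⇒collision s a≉b e v)
                 ; (inj₂ (((a , b) , a≉b) , e) , v) →
                     inj₂ ((((a , b) , a≉b) , e) , col-≉0⇒collision s a≉b e v) })
              (collision? (λ e x → flip (entries s) ⟨ x ∣ e ⟩ᵥ)
                (λ e≈ x≈ → ⟨∣⟩ᵥ-cong (flip (entries s)) x≈ e≈)
               ⊎-dec
               collision? (λ e x → entries s ⟨ x ∣ e ⟩ᵥ) (λ e≈ x≈ → ⟨∣⟩ᵥ-cong (entries s) x≈ e≈))))
            (λ s → inj₁ (fieldGen-vanishes s)))
          (λ s → dichotomy-at nX̄ s degreeGen (Dec.map′
            (λ (i , j , d< , v) → (i , j , d<) , v) (λ ((i , j , d<) , v) → i , j , d< , v)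
            (Fin.any? λ i → Fin.any? λ j →
              (d ℕ.<? toℕ i ℕ.+ toℕ j) ×-dec ¬? (eval nX̄ (x i j) s ≟ 0#)))))
        (λ s → dichotomy-at nX̄ s topGen (Dec.map′ (tt ,_) proj₂ (¬? (eval nX̄ (topGen tt) s ≟ 0#))))

      open Nullstellensatz F 2<q nX̄ 𝒥[ d ] fieldEquation∈ dichotomy public
        using (isRadical; zeros-cardinality; basis; independent; coordinates; spanning)

      record IsLocalPermutationMatrix (c′ : Fin nX → Fin nX → Carrier) : Set (c ⊔ ℓ) where
        field
          injectiveˣ : ∀ y → Injective _≈_ _≈_ (λ x → c′ ⟨ x ∣ y ⟩ᵥ)
          injectiveʸ : ∀ x → Injective _≈_ _≈_ (λ y → c′ ⟨ x ∣ y ⟩ᵥ)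
          degree≤d   : ∀ i j → d < toℕ i ℕ.+ toℕ j → c′ i j ≈ 0#
          top≉0      : ∃₂ λ i j → toℕ i ℕ.+ toℕ j ≡ d × ¬ c′ i j ≈ 0#

      private
        topFactor : Fin nX → Fin nX → Poly nX̄
        topFactor i j = if does (toℕ i ℕ.+ toℕ j ℕ.≟ d) then F⟦ x i j ⟧ else 1ₚ

      eval-topProduct : ∀ s → eval nX̄ (topProduct d) s ≈
                        product λ i → product λ j → eval nX̄ (topFactor i j) s
      eval-topProduct s = trans (product-homo λ i → productₚ (topFactor i))
        (Product.sum-cong-≋ {nX} λ i → product-homo (topFactor i))
        where open Homomorphism (MPoly R nX̄) R (eval-hom nX̄ s)

      zero⇒localPermutation : ∀ s → VanishesAt 𝒥[ d ] s → IsLocalPermutationMatrix (entries s)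
      zero⇒localPermutation s s∈Z = record
        { injectiveˣ = λ e → collisionFree⇒injective λ {a} {b} a≉b eq →
            col-collision⇒≉0 s a≉b e eq (s∈Z _ (G∈ (inj₂ (((a , b) , a≉b) , e))))
        ; injectiveʸ = λ e → collisionFree⇒injective λ {a} {b} a≉b eq →
            row-collision⇒≉0 s a≉b e
              (trans (sym (⟨∣⟩ᵥ-flip (entries s) e a)) (trans eq (⟨∣⟩ᵥ-flip (entries s) e b)))
              (s∈Z _ (G∈ (inj₁ (((a , b) , a≉b) , e))))
        ; degree≤d = λ i j d< → trans (sym (eval-var nX̄ (combine i j) s))
            (s∈Z _ (∈-⊕ˡ J₂ ⟨ topGen ⟩ (∈-⊕ʳ 𝒥 ⟨ degreeGen ⟩ (gen (i , j , d<)))))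
        ; top≉0 = top
        }
        where
        G∈ : ∀ k → G k ∈ 𝒥[ d ]
        G∈ k = ∈-⊕ˡ J₂ ⟨ topGen ⟩ (∈-⊕ˡ 𝒥 ⟨ degreeGen ⟩ (∈-⊕ˡ ⟨ G ⟩ ⟨ fieldGen ⟩ (gen k)))

        top : ∃₂ λ i j → toℕ i ℕ.+ toℕ j ≡ d × ¬ entries s i j ≈ 0#
        -- A vanishing product in a field has a vanishing factor: first a row is found, then an
        -- entry in it. If no pair satisfies i + j = d, all factors are 1 and there is no zero to
        -- treat.
        top with product-zero _ (trans (sym (eval-topProduct s)) (s∈Z _ (∈-⊕ʳ J₂ ⟨ topGen ⟩ (gen tt))))
        ... | i , rowᵢ≈0 with product-zero (λ j → eval nX̄ (topFactor i j) s) rowᵢ≈0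
        ...   | j , factor≈0 with if-F⟦⟧≈0 nX̄ s (toℕ i ℕ.+ toℕ j ℕ.≟ d) (x i j) factor≈0
        ...     | i+j≡d , xᵢⱼ≉0 = i , j , i+j≡d , λ e → xᵢⱼ≉0 (trans (eval-var nX̄ (combine i j) s) e)

      localPermutation⇒zero : ∀ s → IsLocalPermutationMatrix (entries s) → VanishesAt 𝒥[ d ] s
      localPermutation⇒zero s perm = VanishesAt-⊕ J₂ ⟨ topGen ⟩
        (VanishesAt-⊕ 𝒥 ⟨ degreeGen ⟩
          (VanishesAt-⊕ ⟨ G ⟩ ⟨ fieldGen ⟩
            (generators-vanish G s λ
              { (inj₁ (((a , b) , a≉b) , e)) → Dec.decidable-stable (_ ≟ _) λ v → a≉b (injectiveʸ e
                  (trans (⟨∣⟩ᵥ-flip (entries s) e a) (trans (row-≉0⇒collision s a≉b e v)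
                    (sym (⟨∣⟩ᵥ-flip (entries s) e b)))))
              ; (inj₂ (((a , b) , a≉b) , e)) → Dec.decidable-stable (_ ≟ _) λ v →
                  a≉b (injectiveˣ e (col-≉0⇒collision s a≉b e v)) })
            (fieldGen-vanishes s))
          (generators-vanish degreeGen s λ (i , j , d<) →
            trans (eval-var nX̄ (combine i j) s) (degree≤d i j d<)))
        (generators-vanish topGen s λ _ → let (i , j , i+j≡d , cᵢⱼ≉0) = top≉0 in
          trans (eval-topProduct s) (zero-product _ i (zero-product (λ j → eval nX̄ (topFactor i j) s) j
            (≈0-if-F⟦⟧ nX̄ s (toℕ i ℕ.+ toℕ j ℕ.≟ d) (x i j) i+j≡d
              (cᵢⱼ≉0 ∘ trans (sym (eval-var nX̄ (combine i j) s)))))))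
        where open IsLocalPermutationMatrix perm

      module _ (c′ : Fin nX → Fin nX → Carrier) (f : Poly 2) (f≈c : f R[x,y].≈ tabulate₂ c′) where

        eval-f : ∀ a b → eval 2 f (point a b) ≈ c′ ⟨ a ∣ b ⟩ᵥ
        eval-f a b = trans (⟦⟧-cong f≈c) (eval-tabulate₂ c′ (point a b))
          where open Homomorphism (MPoly R 2) R (eval-hom 2 (point a b))

        coefficientAt-f : ∀ i j → coefficientAt f (toℕ i) (toℕ j) ≈ c′ i j
        coefficientAt-f i j = trans (U₁.coeff-≈ (R[x].trans (U₂.coeff-≈ f≈c (toℕ i))
          (P₂.coeff-tabulate (λ i → List.tabulate (c′ i)) i)) (toℕ j)) (P₁.coeff-tabulate (c′ i) j)

        coefficientAt-≥ : ∀ k l → nX ≤ k ⊎ nX ≤ l → coefficientAt f k l ≈ 0#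
        coefficientAt-≥ k l (inj₁ nX≤k) = U₁.coeff-≈ (R[x].trans (U₂.coeff-≈ f≈c k)
          (P₂.coeff-tabulate-≥ (λ i → List.tabulate (c′ i)) nX≤k)) l
        coefficientAt-≥ k l (inj₂ nX≤l) with k ℕ.<? nX
        ... | no  k≮nX = coefficientAt-≥ k l (inj₁ (ℕ.≮⇒≥ k≮nX))
        ... | yes k<nX = ≡.subst (λ k → coefficientAt f k l ≈ 0#) (Fin.toℕ-fromℕ< k<nX)
          (trans (U₁.coeff-≈ (R[x].trans (U₂.coeff-≈ f≈c (toℕ i))
            (P₂.coeff-tabulate (λ i → List.tabulate (c′ i)) i)) l) (P₁.coeff-tabulate-≥ (c′ i) nX≤l))
          where i = fromℕ< k<nX

        localPermutation⇒ℒ𝒫 : IsLocalPermutationMatrix c′ →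
                               IsLocalPermutationPolynomial f × HasTotalDegree 2 f d
        localPermutation⇒ℒ𝒫 perm =
          ( (λ m q≤m → coefficientAt-≥ (m zero) (m (suc zero)) (inj₁ (ℕ.≤-trans (ℕ.m∸n≤m q 1) q≤m)))
          , (λ m q≤m → coefficientAt-≥ (m zero) (m (suc zero)) (inj₂ (ℕ.≤-trans (ℕ.m∸n≤m q 1) q≤m)))
          , λ a → (injˣ a , injective⇒surjective (λ {x} {y} e →
                  eval-cong-point 2 f {point x a} {point y a} λ { zero → e ; (suc zero) → refl }) (injˣ a))
                , (injʸ a , injective⇒surjective (λ {x} {y} e →
                  eval-cong-point 2 f {point a x} {point a y} λ { zero → refl ; (suc zero) → e }) (injʸ a)))
          , (let (i , j , i+j≡d , cᵢⱼ≉0) = top≉0 in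
              exponents (toℕ i) (toℕ j)
              , ≡.trans (≡.cong (toℕ i ℕ.+_) (ℕ.+-identityʳ (toℕ j))) i+j≡d
              , λ e → cᵢⱼ≉0 (trans (sym (coefficientAt-f i j)) e))
          , λ m d<m → high (m zero) (m (suc zero))
              (ℕ.<-≤-trans d<m (ℕ.≤-reflexive (≡.cong (m zero ℕ.+_) (ℕ.+-identityʳ (m (suc zero))))))
          where
          open IsLocalPermutationMatrix perm
          injˣ : ∀ a → Injective _≈_ _≈_ (λ x → eval 2 f (point x a))
          injˣ a {x} {y} e = injectiveˣ a (trans (sym (eval-f x a)) (trans e (eval-f y a)))
          injʸ : ∀ a → Injective _≈_ _≈_ (λ y → eval 2 f (point a y))
          injʸ a {x} {y} e = injectiveʸ a (trans (sym (eval-f a x)) (trans e (eval-f a y)))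
          high : ∀ k l → d < k ℕ.+ l → coefficientAt f k l ≈ 0#
          high k l d< with k ℕ.<? nX | l ℕ.<? nX
          ... | no k≮nX  | _        = coefficientAt-≥ k l (inj₁ (ℕ.≮⇒≥ k≮nX))
          ... | yes _    | no l≮nX  = coefficientAt-≥ k l (inj₂ (ℕ.≮⇒≥ l≮nX))
          ... | yes k<nX | yes l<nX = ≡.subst₂ (λ k l → coefficientAt f k l ≈ 0#)
            (Fin.toℕ-fromℕ< k<nX) (Fin.toℕ-fromℕ< l<nX)
            (trans (coefficientAt-f (fromℕ< k<nX) (fromℕ< l<nX)) (degree≤d _ _
              (≡.subst₂ (λ k l → d < k ℕ.+ l)
                (≡.sym (Fin.toℕ-fromℕ< k<nX)) (≡.sym (Fin.toℕ-fromℕ< l<nX)) d<)))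

        ℒ𝒫⇒localPermutation : IsLocalPermutationPolynomial f → HasTotalDegree 2 f d →
                               IsLocalPermutationMatrix c′
        ℒ𝒫⇒localPermutation (_ , _ , bij) ((m , m≡d , fₘ≉0) , high) = record
          { injectiveˣ = λ a {x} {y} e → proj₁ (proj₁ (bij a)) (trans (eval-f x a) (trans e (sym (eval-f y a))))
          ; injectiveʸ = λ a {x} {y} e → proj₁ (proj₂ (bij a)) (trans (eval-f a x) (trans e (sym (eval-f a y))))
          ; degree≤d = λ i j d< → trans (sym (coefficientAt-f i j))
              (high (exponents (toℕ i) (toℕ j)) (ℕ.<-≤-trans d< (ℕ.≤-reflexive
                (≡.cong (toℕ i ℕ.+_) (≡.sym (ℕ.+-identityʳ (toℕ j)))))))
          ; top≉0 = top
          }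
          where
          k = m zero
          l = m (suc zero)
          top : ∃₂ λ i j → toℕ i ℕ.+ toℕ j ≡ d × ¬ c′ i j ≈ 0#
          -- An exponent of q - 1 or more would make the coefficient zero, so the monomial attaining
          -- the degree is an entry of the matrix.
          top with k ℕ.<? nX | l ℕ.<? nX
          ... | no k≮nX  | _        = contradiction (coefficientAt-≥ k l (inj₁ (ℕ.≮⇒≥ k≮nX))) fₘ≉0
          ... | yes _    | no l≮nX  = contradiction (coefficientAt-≥ k l (inj₂ (ℕ.≮⇒≥ l≮nX))) fₘ≉0
          ... | yes k<nX | yes l<nX = fromℕ< k<nX , fromℕ< l<nX
            , ≡.trans (≡.cong₂ ℕ._+_ (Fin.toℕ-fromℕ< k<nX)
                (≡.trans (Fin.toℕ-fromℕ< l<nX) (≡.sym (ℕ.+-identityʳ l)))) m≡d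
            , λ e → fₘ≉0 (≡.subst₂ (λ k l → coefficientAt f k l ≈ 0#)
                (Fin.toℕ-fromℕ< k<nX) (Fin.toℕ-fromℕ< l<nX)
                (trans (coefficientAt-f (fromℕ< k<nX) (fromℕ< l<nX)) e))

      zeros⤖ℒ𝒫 : Bijection (𝒵 R nX̄ 𝒥[ d ]) (ℒ𝒫 d)
      zeros⤖ℒ𝒫 = record
        { to = λ (s , s∈Z) → bivariatePoly s ,
            localPermutation⇒ℒ𝒫 (entries s) (bivariatePoly s) (bivariatePoly≈tabulate s)
              (zero⇒localPermutation s s∈Z)
        ; cong = λ {(s , _)} {(t , _)} s≈t → R[x,y].trans (bivariatePoly≈tabulate s)
            (R[x,y].trans (tabulate₂-cong λ i j → s≈t (combine i j)) (R[x,y].sym (bivariatePoly≈tabulate t)))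
        ; bijective =
            (λ {(s , _)} {(t , _)} e k → let (i , j , ij≡k) = Fin.combine-surjective {nX} {nX} k in
              ≡.subst (λ k → s k ≈ t k) ij≡k (trans
                (sym (coefficientAt-f (entries s) (bivariatePoly s) (bivariatePoly≈tabulate s) i j))
                (trans (U₁.coeff-≈ (U₂.coeff-≈ e (toℕ i)) (toℕ j))
                  (coefficientAt-f (entries t) (bivariatePoly t) (bivariatePoly≈tabulate t) i j))))
          , λ (f , perm , total) → let f≈ = localPermutation≈tabulate f perm in
              (coefficients f , localPermutation⇒zero _ (ℒ𝒫⇒localPermutation _ f f≈ perm total))
              , λ {(s , _)} e → R[x,y].trans (bivariatePoly≈tabulate s)
                  (R[x,y].trans (tabulate₂-cong λ i j → e (combine i j)) (R[x,y].sym f≈))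
        }

  -- The ideal is indexed by an element of `Fin nX` and 𝒫 by a natural number. With `d` a variable,
  -- the equation can be matched, which is impossible once `i` is a concrete `fromℕ<`.
  zeros≅𝒫 : ∀ {d} (i : Fin nX) → toℕ i ≡ d →
            Σ[ φ ∈ Bijection (𝒵 R nX ℐ[ i ]) (𝒫 d) ]
              (∀ s → proj₁ (Bijection.to φ s) R[x].≈ univariatePoly (proj₁ s))
  zeros≅𝒫 i ≡.refl = Univariate-𝒫.OfDegree.zeros⤖𝒫 i , λ _ → R[x].refl

  zeros≅ℒ𝒫 : ∀ d →
             Σ[ φ ∈ Bijection (𝒵 R nX̄ 𝒥[ d ]) (ℒ𝒫 d) ]
               (∀ s → proj₁ (Bijection.to φ s) R[x,y].≈ bivariatePoly (proj₁ s))
  zeros≅ℒ𝒫 d = Bivariate-ℒ𝒫.OfDegree.zeros⤖ℒ𝒫 d , λ _ → R[x,y].refl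

lemma3p2 :
  ∀ {c ℓ} (q : ℕ) (F : FiniteField c ℓ q) →
  IsPrimePower q → (3<q : 3 < q) → (d : ℕ) →
  let open OverFiniteField F
      R = FiniteField.commutativeRing F
  in
  ((d≤q-2 : d ≤ q ∸ 2) →
    let open Ideals (MPoly R nX) using (IsRadical)
        open CommutativeRing (MPoly R 1) using () renaming (_≈_ to _≈[x]_)
        I = ℐ[ fromℕ< (≤q-2⇒<q-1 3<q d≤q-2) ]
        Z = 𝒵 R nX I
    in
    IsZeroDimensional R nX I ×
    IsRadical I ×
    (Σ[ φ ∈ Bijection Z (𝒫 d) ]
      (∀ s → proj₁ (Bijection.to φ s) ≈[x] univariatePoly (proj₁ s))) ×
    (∃[ k ] HasCardinality (𝒫 d) k ×
            HasCardinality Z k ×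
            HasDimension (quotient R nX I) k))
  ×
  (let open Ideals (MPoly R nX̄) using (IsRadical)
       open CommutativeRing (MPoly R 2) using () renaming (_≈_ to _≈[x,y]_)
       J = 𝒥[ d ]
       Z = 𝒵 R nX̄ J
   in
    IsZeroDimensional R nX̄ J ×
    IsRadical J ×
    (Σ[ φ ∈ Bijection Z (ℒ𝒫 d) ]
      (∀ s → proj₁ (Bijection.to φ s) ≈[x,y] bivariatePoly (proj₁ s))) ×
    (∃[ k ] HasCardinality (ℒ𝒫 d) k ×
            HasCardinality Z k ×
            HasDimension (quotient R nX̄ J) k))
-- Bases are rebuilt field by field: transporting one along an equality of two
-- presentations of `quotient` would compare all the law proofs of the module.
lemma3p2 q F _ 3<q d =
  (λ d≤q-2 →
    let i = fromℕ< (≤q-2⇒<q-1 3<q d≤q-2)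
        φ = PermutationIdeals.zeros≅𝒫 F 2<q i (Fin.toℕ-fromℕ< (≤q-2⇒<q-1 3<q d≤q-2))
        k , |Z|≡k = 𝒫.zeros-cardinality i
    in
    (k , 𝒫.basis i |Z|≡k , record
      { independent = λ a (modulo e) → 𝒫.independent i |Z|≡k a e
      ; spanning    = λ f → 𝒫.coordinates i |Z|≡k f , modulo (𝒫.spanning i |Z|≡k f)
      }) ,
    𝒫.isRadical i ,
    φ ,
    k , cardinality-transport (proj₁ φ) |Z|≡k , |Z|≡k , 𝒫.basis i |Z|≡k , record
      { independent = λ a (modulo e) → 𝒫.independent i |Z|≡k a e
      ; spanning    = λ f → 𝒫.coordinates i |Z|≡k f , modulo (𝒫.spanning i |Z|≡k f)
      }) ,
  (let φ = PermutationIdeals.zeros≅ℒ𝒫 F 2<q d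
       k , |Z|≡k = ℒ𝒫.zeros-cardinality d
   in
   (k , ℒ𝒫.basis d |Z|≡k , record
     { independent = λ a (modulo e) → ℒ𝒫.independent d |Z|≡k a e
     ; spanning    = λ f → ℒ𝒫.coordinates d |Z|≡k f , modulo (ℒ𝒫.spanning d |Z|≡k f)
     }) ,
   ℒ𝒫.isRadical d ,
   φ ,
   k , cardinality-transport (proj₁ φ) |Z|≡k , |Z|≡k , ℒ𝒫.basis d |Z|≡k , record
     { independent = λ a (modulo e) → ℒ𝒫.independent d |Z|≡k a e
     ; spanning    = λ f → ℒ𝒫.coordinates d |Z|≡k f , modulo (ℒ𝒫.spanning d |Z|≡k f)
     })
  where
  2<q : 2 < q
  2<q = ℕ.<-trans ℕ.≤-refl 3<q
  module 𝒫 = PermutationIdeals.Univariate-𝒫.OfDegree F 2<q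
  module ℒ𝒫 = PermutationIdeals.Bivariate-ℒ𝒫.OfDegree F 2<q
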